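{- For every positive integer $k$, the digraph $\mathbb{Z}(\Theta_\infty,k)$ has polynomial growth of degree $k+1$, has only one end, and is sharply $k$-arc-transitive.
   Context: A digraph $\Gamma$ is a pair $(\mathrm V\Gamma,\mathrm E\Gamma)$ with $\mathrm E\Gamma\subseteq \mathrm V\Gamma\times \mathrm V\Gamma$ the set of arcs (loops are allowed). A $k$-arc is a sequence $(v_0,\dots,v_k)$ of vertices with $(v_{i-1},v_i)$ an arc for $1\le i\le k$. $\Gamma$ is $k$-arc-transitive if $\mathrm{Aut}(\Gamma)$ acts transitively on the set of $k$-arcs; sharply $k$-arc-transitive means $k$-arc-transitive but not $(k+1)$-arc-transitive. For a digraph $\Delta$ with vertex set $V$ and a positive integer $k$, $\mathbb{Z}(\Delta,k)$ is the digraph with vertex set $\mathbb{Z}\times V^k$ in which the out-neighbours of $(i;v_0,\dots,v_{k-1})$ are the vertices $(i+1;w_0,\dots,w_{k-1})$ such that $v_j=w_j$ if $j\not\equiv i \pmod k$, and $(v_j,w_j)\in \mathrm E\Delta$ if $j\equiv i\pmod k$. $\Theta_\infty$ is the infinite directed line with a loop attached at every vertex (vertex set $\mathbb{Z}$, arcs $(x,x)$ and $(x,x+1)$). A path of length $n$ is a sequence $v_0,a_1,v_1,\dots,a_n,v_n$ with the $v_i$ pairwise distinct vertices and each $a_i$ an arc equal to $(v_{i-1},v_i)$ or $(v_i,v_{i-1})$ (so paths ignore directions); a ray is a one-way infinite path. For a connected digraph and a vertex $v$, $b_n(v)$ is the number of vertices that can be reached from $v$ by a path of length $\le n$. The digraph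 has polynomial growth if there is a polynomial $P$ with $b_n(v)\le P(n)$ for all $n\ge 0$ (this does not depend on the choice of $v$ in the vertex-transitive setting considered here); the lowest possible degree of such a $P$ is the degree of the growth. The ends of a digraph are the equivalence classes of rays, where two rays are equivalent if there is an infinite family of pairwise disjoint paths all with initial vertex in one of the rays and terminal vertex in the other. -}

module Defs where

open import Data.Fin.Base using (Fin; zero; suc; inject₁; fromℕ; toℕ)
open import Data.Integer.Base as ℤ using (ℤ; +_; 1ℤ)
open import Data.Integer.Divisibility using (_∣_)
open import Data.List.Base using (List; []; _∷_; length)
open import Data.List.Membership.Propositional using (_∈_)
open import Data.List.Relation.Unary.Unique.Propositional using (Unique)
open import Data.Nat.Base as ℕ using (ℕ; zero; suc)
open import Data.Product.Base using (Σ-syntax; ∃; ∃-syntax; _×_; _,_)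
open import Data.Rational.Base as ℚ using (ℚ; 0ℚ)
open import Data.Sum.Base using (_⊎_)
open import Data.Vec.Base using (Vec; lookup)
open import Function.Bundles using (_↔_; _⇔_; Inverse)
open import Function.Definitions using (Injective)
open import Level using (0ℓ)
open import Relation.Binary.Core using (Rel)
open import Relation.Binary.PropositionalEquality.Core using (_≡_; _≢_)
open import Relation.Nullary.Negation.Core using (¬_)
open import Relation.Unary using (Pred)

record Digraph : Set₁ where
  field
    Vertex : Set
    Arc    : Rel Vertex 0ℓ

  Adjacent : Rel Vertex 0ℓ
  Adjacent u v = Arc u v ⊎ Arc v u

open Digraph public using (Vertex)

module _ (Γ : Digraph) where
  open Digraph Γ using (Arc; Adjacent)

  record Automorphism : Set where
    field
      bijection : Vertex Γ ↔ Vertex Γ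

    open Inverse bijection public using (to; from)

    field
      preserves-arcs : ∀ u v → Arc u v ⇔ Arc (to u) (to v)

  record _-arc (k : ℕ) : Set where
    field
      vertex : Fin (suc k) → Vertex Γ
      arc    : ∀ i → Arc (vertex (inject₁ i)) (vertex (suc i))

  ArcTransitive : ℕ → Set
  ArcTransitive k = (a b : k -arc) →
    Σ[ φ ∈ Automorphism ]
      (∀ i → Automorphism.to φ (_-arc.vertex a i) ≡ _-arc.vertex b i)

  SharplyArcTransitive : ℕ → Set
  SharplyArcTransitive k = ArcTransitive k × ¬ ArcTransitive (suc k)

  record Path (n : ℕ) : Set where
    field
      vertex   : Fin (suc n) → Vertex Γ
      distinct : Injective _≡_ _≡_ vertex
      step     : ∀ i → Adjacent (vertex (inject₁ i)) (vertex (suc i))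

    initial terminal : Vertex Γ
    initial  = vertex zero
    terminal = vertex (fromℕ n)

  record Ray : Set where
    field
      vertex   : ℕ → Vertex Γ
      distinct : Injective _≡_ _≡_ vertex
      step     : ∀ i → Adjacent (vertex i) (vertex (suc i))

  Joins : ∀ {n} → Path n → Rel (Vertex Γ) 0ℓ
  Joins p u v = Path.initial p ≡ u × Path.terminal p ≡ v

  Connected : Set
  Connected = ∀ u v → ∃[ n ] Σ[ p ∈ Path n ] Joins p u v

  Ball : Vertex Γ → ℕ → Pred (Vertex Γ) 0ℓ
  Ball v n w = ∃[ m ] m ℕ.≤ n × Σ[ p ∈ Path m ] Joins p v w

  Disjoint : ∀ {m n} → Path m → Path n → Set
  Disjoint p q = ∀ i j → Path.vertex p i ≢ Path.vertex q j

  _LiesOn_ : Vertex Γ → Ray → Set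
  v LiesOn R = ∃[ i ] Ray.vertex R i ≡ v

  record EquivalentRays (R S : Ray) : Set where
    field
      size     : ℕ → ℕ
      path     : ∀ n → Path (size n)
      disjoint : ∀ m n → m ≢ n → Disjoint (path m) (path n)
      initial  : ∀ n → Path.initial (path n) LiesOn R
      terminal : ∀ n → Path.terminal (path n) LiesOn S

  OneEnd : Set
  OneEnd = Ray × (∀ R S → EquivalentRays R S)

HasCardinality : {A : Set} → Pred A 0ℓ → ℕ → Set
HasCardinality {A} P m =
  Σ[ xs ∈ List A ] Unique xs × (∀ x → x ∈ xs ⇔ P x) × length xs ≡ m

-- Coefficients in order of increasing degree; trailing zeros are allowed.
Polynomial : Set
Polynomial = List ℚ

eval : Polynomial → ℚ → ℚ
eval []      x = 0ℚ
eval (a ∷ p) x = a ℚ.+ x ℚ.* eval p x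

coefficient : Polynomial → ℕ → ℚ
coefficient []      _       = 0ℚ
coefficient (a ∷ p) zero    = a
coefficient (a ∷ p) (suc i) = coefficient p i

-- The zero polynomial has no degree.
HasDegree : Polynomial → ℕ → Set
HasDegree p d = coefficient p d ≢ 0ℚ × (∀ i → d ℕ.< i → coefficient p i ≡ 0ℚ)

fromNat : ℕ → ℚ
fromNat n = + n ℚ./ 1

module _ (Γ : Digraph) where

  -- b_n(v) is the number m; in particular the balls around v are finite.
  GrowthBoundedBy : Vertex Γ → Polynomial → Set
  GrowthBoundedBy v p =
    ∀ n → ∃[ m ] HasCardinality (Ball Γ v n) m × fromNat m ℚ.≤ eval p (fromNat n)

  -- Growth is only defined for connected digraphs, hence the first field.
  record PolynomialGrowthOfDegree (d : ℕ) : Set where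
    field
      connected : Connected Γ
      bounded   : ∀ v → ∃[ p ] HasDegree p d × GrowthBoundedBy v p
      minimal   : ∀ v p e → HasDegree p e → GrowthBoundedBy v p → d ℕ.≤ e

infix 4 _≡_[mod_]

_≡_[mod_] : ℤ → ℤ → ℕ → Set
i ≡ j [mod k ] = + k ∣ i ℤ.- j

ℤ[_,_] : Digraph → ℕ → Digraph
ℤ[ Δ , k ] = record
  { Vertex = ℤ × Vec (Vertex Δ) k
  ; Arc    = λ (i , v) (i′ , w) →
      i′ ≡ i ℤ.+ 1ℤ ×
      (∀ (j : Fin k) →
        (¬ + toℕ j ≡ i [mod k ] → lookup v j ≡ lookup w j) ×
        (+ toℕ j ≡ i [mod k ] → Digraph.Arc Δ (lookup v j) (lookup w j)))
  }

Θ∞ : Digraph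
Θ∞ = record
  { Vertex = ℤ
  ; Arc    = λ x y → y ≡ x ⊎ y ≡ x ℤ.+ 1ℤ
  }

{-# OPTIONS --safe #-}
module Submission where

-- Call i the level of the vertex (i ; v).  An arc raises the level by one and may raise the coordinate
-- v_c with c ≡ i (mod k), the one active at level i, by one; no other coordinate changes.
--
-- Growth.  In the sup metric on ℤ × ℤ^k an arc has length at most one, while any coordinate can be
-- changed by one in at most 2k steps by walking to a level where it is active and back.  So balls
-- lie between sup-balls whose radii are linear in n, and sup-balls have (2n+1)^(k+1) elements.
--
-- Ends.  A vertex outside a large sup-ball either has a level large in absolute value, where all
-- coordinates can be changed outside the ball, or a large coordinate, which allows the level to be
-- changed outside the ball.  So far-away vertices are joined by paths avoiding the ball.
--
-- Arc-transitivity.  Let N_c(i) count the levels below i at which c is active.  Besides the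
-- translations, v_c ↦ N_c(i) - v_c is an automorphism; it exchanges the steps that raise v_c with the
-- steps at which v_c is active and stays.  As each coordinate is active once in a k-arc, these
-- automorphisms map it to an arc with all coordinates 0, and a shift of the levels combined with a
-- rotation of the coordinates maps any two such arcs to each other.  For (k+1)-arcs, the number of
-- (k+1)-arcs with the same ends is an obstruction: one coordinate is active twice, and raising it
-- exactly once can be done in two ways.

open import Defs
open import Data.Fin.Base using (Fin; zero; suc; inject₁; fromℕ; toℕ; fromℕ<)
open import Data.Fin.Induction using (<-weakInduction; >-weakInduction)
import Data.Fin.Properties as Fin
open import Data.Integer.Base as ℤ using (ℤ; +_; -[1+_]; 0ℤ; 1ℤ; ∣_∣; _/ℕ_; _%ℕ_)
open import Data.Integer.DivMod using (n%ℕd<d; a≡a%ℕn+[a/ℕn]*n)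
import Data.Integer.Divisibility.Signed as Signed
import Data.Integer.Properties as ℤ
open import Algebra.Properties.AbelianGroup ℤ.+-0-abelianGroup using (∙-cancelˡ)
open import Data.Integer.Tactic.RingSolver using (solve-∀)
open import Data.List.Base using (List; []; _∷_; _++_; length; map; upTo; filter; cartesianProduct; cartesianProductWith)
open import Data.List.Membership.Propositional using (_∈_; find; lose)
open import Data.List.Membership.Propositional.Properties using (∈-∃++; ∈-++⁻; ∈-++⁺ˡ; ∈-++⁺ʳ; ∈-map⁺; ∈-map⁻;
  ∈-upTo⁺; ∈-upTo⁻; ∈-filter⁺; ∈-filter⁻; ∈-cartesianProduct⁺; ∈-cartesianProduct⁻;
  ∈-cartesianProductWith⁺; ∈-cartesianProductWith⁻)
open import Data.List.Properties using (length-++; length-map; length-upTo; length-filter)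
open import Data.List.Relation.Binary.Subset.Propositional using (_⊆_)
import Data.List.Relation.Unary.All as All
open import Data.List.Relation.Unary.All.Properties using (¬All⇒Any¬)
open import Data.List.Relation.Unary.AllPairs using ([]; _∷_)
open import Data.List.Relation.Unary.Any using (here; there; any?)
open import Data.List.Relation.Unary.Unique.Propositional using (Unique)
import Data.List.Relation.Unary.Unique.Propositional.Properties as Unique
open import Data.Nat.Base using (ℕ; zero; suc; pred; _+_; _*_; _^_; _∸_; _⊔_; _⊓_; _≤_; _<_; z≤n; s≤s; NonZero; >-nonZero⁻¹)
import Data.Nat.Divisibility as ℕ
open import Data.Nat.Properties
import Data.Nat.Tactic.RingSolver as ℕ
open import Data.Product.Base using (Σ-syntax; ∃-syntax; _×_; _,_; proj₁; proj₂)
import Data.Product.Properties as Product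
open import Data.Rational.Base as ℚ using (0ℚ; mkℚ)
import Data.Rational.Properties as ℚ
open import Data.Rational.Unnormalised.Base as ℚᵘ using (mkℚᵘ; *≡*; *≤*)
import Data.Rational.Unnormalised.Properties as ℚᵘ
open import Data.Sum.Base using (_⊎_; inj₁; inj₂; swap)
open import Data.Unit.Base using (⊤; tt)
open import Data.Vec.Base as Vec using (Vec; []; _∷_; lookup; tabulate; _[_]≔_)
import Data.Vec.Properties as Vec
open import Function.Base using (_∘_; const)
open import Function.Bundles using (_⇔_; mk⇔; mk↔ₛ′; Equivalence; Inverse)
open import Level using (0ℓ)
open import Relation.Binary.Definitions using (DecidableEquality; tri<; tri≈; tri>)
open import Relation.Binary.PropositionalEquality
open import Relation.Nullary using (¬_; Dec; yes; no; contradiction)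
open import Relation.Nullary.Decidable using (map′; ¬?; _×-dec_; _⊎-dec_; _→-dec_)
open import Relation.Unary using (Pred)

-- Counting in lists and finite suprema.

unique-⊆⇒length≤ : {A : Set} {xs ys : List A} → Unique xs → xs ⊆ ys → length xs ≤ length ys
unique-⊆⇒length≤ [] _ = z≤n
unique-⊆⇒length≤ {xs = x ∷ xs} (x∉xs ∷ xs!) xs⊆ys with ∈-∃++ (xs⊆ys (here refl))
-- Deleting this occurrence of `x` from the larger list keeps every element of `xs` in it, because
-- `x` does not recur in `xs`.
... | as , bs , refl = begin
  suc (length xs)               ≤⟨ s≤s (unique-⊆⇒length≤ xs! xs⊆as++bs) ⟩
  suc (length (as ++ bs))       ≡⟨ cong suc (length-++ as) ⟩
  suc (length as + length bs)   ≡⟨ +-suc (length as) (length bs) ⟨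
  length as + suc (length bs)   ≡⟨ length-++ as ⟨
  length (as ++ x ∷ bs)         ∎
  where
  open ≤-Reasoning
  xs⊆as++bs : xs ⊆ as ++ bs
  xs⊆as++bs z∈xs with ∈-++⁻ as (xs⊆ys (there z∈xs))
  ... | inj₁ z∈as         = ∈-++⁺ˡ z∈as
  ... | inj₂ (here refl)  = contradiction refl (All.lookup x∉xs z∈xs)
  ... | inj₂ (there z∈bs) = ∈-++⁺ʳ as z∈bs

supremum : ∀ {n} → (Fin n → ℕ) → ℕ
supremum {zero}  f = 0
supremum {suc n} f = f zero ⊔ supremum (f ∘ suc)

≤-supremum : ∀ {n} (f : Fin n → ℕ) i → f i ≤ supremum f
≤-supremum f zero    = m≤m⊔n _ _
≤-supremum f (suc i) = ≤-trans (≤-supremum (f ∘ suc) i) (m≤n⊔m _ _)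

supremum-lub : ∀ {n b} {f : Fin n → ℕ} → (∀ i → f i ≤ b) → supremum f ≤ b
supremum-lub {zero}  f≤b = z≤n
supremum-lub {suc n} f≤b = ⊔-lub (f≤b zero) (supremum-lub (f≤b ∘ suc))

<-⊔⁻ : ∀ {l} m n → l < m ⊔ n → l < m ⊎ l < n
<-⊔⁻ m n l<m⊔n with ⊔-sel m n
... | inj₁ eq = inj₁ (subst (_ <_) eq l<m⊔n)
... | inj₂ eq = inj₂ (subst (_ <_) eq l<m⊔n)

-- The strict inequality rules out the empty family, whose supremum is 0. This is how a large
-- distance yields a single large coordinate.
<-supremum⁻ : ∀ {n l} (f : Fin n → ℕ) → l < supremum f → ∃[ i ] l < f i
<-supremum⁻ {suc n} f l<sup with <-⊔⁻ (f zero) _ l<sup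
... | inj₁ l<f0 = zero , l<f0
... | inj₂ l<s  with <-supremum⁻ (f ∘ suc) l<s
...   | i , l<fi = suc i , l<fi

-- Walks and paths.

module _ (Γ : Digraph) where
  open Digraph Γ using (Adjacent)

  -- The index n is only an upper bound for the length.
  data Walk (P : Pred (Vertex Γ) 0ℓ) : ℕ → Vertex Γ → Vertex Γ → Set where
    nil  : ∀ {n u} → P u → Walk P n u u
    cons : ∀ {n u v w} → P u → Adjacent u v → Walk P n v w → Walk P (suc n) u w

module _ {Γ : Digraph} where
  open Digraph Γ using (Arc; Adjacent)
  private variable
    P : Pred (Vertex Γ) 0ℓ
    m n : ℕ
    u v w : Vertex Γ

  weaken : m ≤ n → Walk Γ P m u v → Walk Γ P n u v
  weaken m≤n       (nil pu)        = nil pu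
  weaken (s≤s m≤n) (cons pu a walk) = cons pu a (weaken m≤n walk)

  append : Walk Γ P m u v → Walk Γ P n v w → Walk Γ P (m + n) u w
  append {m = m} (nil _)          walk′ = weaken (m≤n+m _ m) walk′
  append         (cons pu a walk) walk′ = cons pu a (append walk walk′)

  snoc : Walk Γ P n u v → Adjacent v w → P w → Walk Γ P (suc n) u w
  snoc (nil pu)         a pw = cons pu a (nil pw)
  snoc (cons pu b walk) a pw = cons pu b (snoc walk a pw)

  reverse : Walk Γ P n u v → Walk Γ P n v u
  reverse (nil pu)         = nil pu
  reverse (cons pu a walk) = snoc (reverse walk) (swap a) pu

  Within : Pred (Vertex Γ) 0ℓ → Path Γ n → Set
  Within P p = ∀ i → P (Path.vertex p i)

  tail : Path Γ (suc n) → Path Γ n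
  tail p = record
    { vertex   = Path.vertex p ∘ suc
    ; distinct = Fin.suc-injective ∘ Path.distinct p
    ; step     = Path.step p ∘ suc
    }

  suffix : (p : Path Γ n) → Within P p → ∀ i →
    ∃[ m ] m ≤ n × Σ[ q ∈ Path Γ m ] Joins Γ q (Path.vertex p i) (Path.terminal p) × Within P q
  suffix                     p inP zero    = _ , ≤-refl , p , (refl , refl) , inP
  suffix {n = suc n} {P = P} p inP (suc i) with suffix {P = P} (tail p) (inP ∘ suc) i
  ... | m , m≤n , q , joins , inP′ = m , m≤n⇒m≤1+n m≤n , q , joins , inP′

  prepend : (p : Path Γ n) → (∀ i → Path.vertex p i ≢ u) → Adjacent u (Path.initial p) → Path Γ (suc n)
  prepend {u = u} p fresh a = record { vertex = vertex ; distinct = distinct ; step = step }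
    where
    vertex : Fin _ → Vertex Γ
    vertex zero    = u
    vertex (suc i) = Path.vertex p i

    distinct : ∀ {i j} → vertex i ≡ vertex j → i ≡ j
    distinct {zero}  {zero}  _  = refl
    distinct {zero}  {suc j} eq = contradiction (sym eq) (fresh j)
    distinct {suc i} {zero}  eq = contradiction eq (fresh i)
    distinct {suc i} {suc j} eq = cong suc (Path.distinct p eq)

    step : ∀ i → Adjacent (vertex (inject₁ i)) (vertex (suc i))
    step zero    = a
    step (suc i) = Path.step p i

  path⇒walk : (p : Path Γ n) → Walk Γ (const ⊤) n (Path.initial p) (Path.terminal p)
  path⇒walk {n = zero}  p = nil tt
  path⇒walk {n = suc n} p = cons tt (Path.step p zero) (path⇒walk (tail p))

  module _ (_≟_ : DecidableEquality (Vertex Γ)) where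

    -- Loop erasure: if the first vertex of the walk recurs on the path made from the rest, that
    -- path is cut down to its part from the recurrence on. No new vertices appear, so `P` survives.
    walk⇒path : Walk Γ P n u v → ∃[ m ] m ≤ n × Σ[ p ∈ Path Γ m ] Joins Γ p u v × Within P p
    walk⇒path {u = u} (nil pu) =
      0 , z≤n , record { vertex = const u ; distinct = λ { {zero} {zero} _ → refl } ; step = λ () }
        , (refl , refl) , const pu
    walk⇒path {P = P} {u = u} (cons pu a walk) with walk⇒path walk
    ... | m , m≤n , p , (refl , refl) , inP with Fin.any? (λ i → Path.vertex p i ≟ u)
    ...   | no u∉p = suc m , s≤s m≤n , prepend p (λ i eq → u∉p (i , eq)) a , (refl , refl)
                   , λ { zero → pu ; (suc i) → inP i }
    ...   | yes (i , refl) with suffix {P = P} p inP i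
    ...     | l , l≤m , q , joins , inP′ = l , ≤-trans l≤m (m≤n⇒m≤1+n m≤n) , q , joins , inP′

    -- Allows balls to be treated through walks, which compose freely because their vertices may
    -- repeat.
    ball⇔walk : Ball Γ u n v ⇔ Walk Γ (const ⊤) n u v
    ball⇔walk = mk⇔ (λ { (m , m≤n , p , refl , refl) → weaken m≤n (path⇒walk p) })
                    (λ walk → let m , m≤n , p , joins , _ = walk⇒path walk in m , m≤n , p , joins)

  module _ (_≟_ : DecidableEquality (Vertex Γ)) (nbhd : Vertex Γ → List (Vertex Γ))
           (adjacent? : ∀ u v → Dec (Adjacent u v)) (adjacent⇒∈ : ∀ {u v} → Adjacent u v → v ∈ nbhd u) where

    -- Search through the first step. The list `nbhd u` may also contain vertices that are not
    -- neighbours of `u`, so each candidate is tested with `adjacent?`.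
    walk? : ∀ n u v → Dec (Walk Γ (const ⊤) n u v)
    walk? zero u v with u ≟ v
    ... | yes refl = yes (nil tt)
    ... | no  u≢v  = no λ { (nil _) → u≢v refl }
    walk? (suc n) u v with u ≟ v | any? (λ x → adjacent? u x ×-dec walk? n x v) (nbhd u)
    ... | yes refl | _      = yes (nil tt)
    ... | no  u≢v  | yes ∃x = let _ , _ , a , walk = find ∃x in yes (cons tt a walk)
    ... | no  u≢v  | no ∄x  = no λ
      { (nil _)         → u≢v refl
      ; (cons _ a walk) → ∄x (lose (adjacent⇒∈ a) (a , walk))
      }

  -- Automorphisms of a digraph.

  automorphism : (f g : Vertex Γ → Vertex Γ) → (∀ u → f (g u) ≡ u) → (∀ u → g (f u) ≡ u) →
    (∀ u v → Arc u v → Arc (f u) (f v)) → (∀ u v → Arc u v → Arc (g u) (g v)) → Automorphism Γ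
  automorphism f g f∘g g∘f f-arc g-arc = record
    { bijection      = mk↔ₛ′ f g f∘g g∘f
    ; preserves-arcs = λ u v → mk⇔ (f-arc u v) (subst₂ Arc (g∘f u) (g∘f v) ∘ g-arc (f u) (f v))
    }

  module _ (φ : Automorphism Γ) where
    open Automorphism φ

    to-from : ∀ u → to (from u) ≡ u
    to-from u = Inverse.strictlyInverseˡ bijection u

    from-to : ∀ u → from (to u) ≡ u
    from-to u = Inverse.strictlyInverseʳ bijection u

    to-arc : ∀ u v → Arc u v → Arc (to u) (to v)
    to-arc u v = Equivalence.to (preserves-arcs u v)

    from-arc : ∀ u v → Arc u v → Arc (from u) (from v)
    from-arc u v a = Equivalence.from (preserves-arcs (from u) (from v))
                       (subst₂ Arc (sym (to-from u)) (sym (to-from v)) a)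

  inverse : Automorphism Γ → Automorphism Γ
  inverse φ = automorphism from to (from-to φ) (to-from φ) (from-arc φ) (to-arc φ)
    where open Automorphism φ

  compose : Automorphism Γ → Automorphism Γ → Automorphism Γ
  compose φ ψ = automorphism (φ.to ∘ ψ.to) (ψ.from ∘ φ.from)
    (λ u → trans (cong φ.to (to-from ψ _)) (to-from φ u))
    (λ u → trans (cong ψ.from (from-to φ _)) (from-to ψ u))
    (λ u v → to-arc φ (ψ.to u) (ψ.to v) ∘ to-arc ψ u v)
    (λ u v → from-arc ψ (φ.from u) (φ.from v) ∘ from-arc φ u v)
    where
    module φ = Automorphism φ
    module ψ = Automorphism ψ

-- Congruence modulo `k`, residues and quotients.

module Residues (k : ℕ) .{{_ : NonZero k}} where

  -- A wrapper that lets i and j be inferred.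
  infix 4 _≋_
  record _≋_ (i j : ℤ) : Set where
    constructor congruent
    field divisible : i ≡ j [mod k ]
  open _≋_ public

  multiple⇒≋ : ∀ {i j} q → i ℤ.- j ≡ q ℤ.* + k → i ≋ j
  multiple⇒≋ q eq = congruent (Signed.∣⇒∣ᵤ (Signed.divides q eq))

  ≋⇒multiple : ∀ {i j} → i ≋ j → ∃[ q ] i ℤ.- j ≡ q ℤ.* + k
  ≋⇒multiple {i} {j} i≋j with Signed.∣ᵤ⇒∣ {+ k} {i ℤ.- j} (divisible i≋j)
  ... | Signed.divides q eq = q , eq

  ≋-refl : ∀ {i} → i ≋ i
  ≋-refl {i} = multiple⇒≋ 0ℤ (ℤ.+-inverseʳ i)

  ≋-sym : ∀ {i j} → i ≋ j → j ≋ i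
  ≋-sym {i} {j} i≋j with ≋⇒multiple i≋j
  ... | q , eq = multiple⇒≋ (ℤ.- q) (trans (negate i j) (trans (cong ℤ.-_ eq) (ℤ.neg-distribˡ-* q (+ k))))
    where
    negate : ∀ i j → j ℤ.- i ≡ ℤ.- (i ℤ.- j)
    negate = solve-∀

  ≋-trans : ∀ {i j l} → i ≋ j → j ≋ l → i ≋ l
  ≋-trans {i} {j} {l} i≋j j≋l with ≋⇒multiple i≋j | ≋⇒multiple j≋l
  ... | p , eq | q , eq′ =
    multiple⇒≋ (p ℤ.+ q) (trans (split i j l) (trans (cong₂ ℤ._+_ eq eq′) (sym (ℤ.*-distribʳ-+ (+ k) p q))))
    where
    split : ∀ i j l → i ℤ.- l ≡ (i ℤ.- j) ℤ.+ (j ℤ.- l)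
    split = solve-∀

  ≋-+ʳ : ∀ {i j} l → i ≋ j → i ℤ.+ l ≋ j ℤ.+ l
  ≋-+ʳ {i} {j} l i≋j with ≋⇒multiple i≋j
  ... | q , eq = multiple⇒≋ q (trans (cancel i j l) eq)
    where
    cancel : ∀ i j l → (i ℤ.+ l) ℤ.- (j ℤ.+ l) ≡ i ℤ.- j
    cancel = solve-∀

  infix 4 _≋?_
  _≋?_ : ∀ i j → Dec (i ≋ j)
  i ≋? j = map′ congruent divisible (k ℕ.∣? ∣ i ℤ.- j ∣)

  -- The difference of two numbers below `k` has absolute value below `k`, and 0 is the only
  -- multiple of `k` of that size.
  remainder-unique : ∀ {m n} → m < k → n < k → + m ≋ + n → m ≡ n
  remainder-unique {m} {n} m<k n<k m≋n =
    ℤ.+-injective (ℤ.i-j≡0⇒i≡j (+ m) (+ n) (ℤ.∣i∣≡0⇒i≡0 (small _ d<k (divisible m≋n))))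
    where
    d<k : ∣ + m ℤ.- + n ∣ < k
    d<k = subst (λ d → ∣ d ∣ < k) (sym (ℤ.m-n≡m⊖n m n)) (≤-<-trans (ℤ.∣m⊝n∣≤m⊔n m n) (⊔-pres-<m m<k n<k))

    small : ∀ d → d < k → k ℕ.∣ d → d ≡ 0
    small zero    _   _   = refl
    small (suc d) d<k k∣d = contradiction k∣d (ℕ.>⇒∤ d<k)

  residue-unique : {c d : Fin k} → + toℕ c ≋ + toℕ d → c ≡ d
  residue-unique {c} {d} = Fin.toℕ-injective ∘ remainder-unique (Fin.toℕ<n c) (Fin.toℕ<n d)

  ≋-remainder : ∀ {i} r q → i ≡ + r ℤ.+ q ℤ.* + k → + r ≋ i
  ≋-remainder r q refl = multiple⇒≋ (ℤ.- q) (cancel (+ r) q (+ k))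
    where
    cancel : ∀ r q d → r ℤ.- (r ℤ.+ q ℤ.* d) ≡ ℤ.- q ℤ.* d
    cancel = solve-∀

  %ℕ-≋ : ∀ i → + (i %ℕ k) ≋ i
  %ℕ-≋ i = ≋-remainder (i %ℕ k) (i /ℕ k) (a≡a%ℕn+[a/ℕn]*n i k)

  -- The one coordinate that is active at level `i`.
  residue : ℤ → Fin k
  residue i = fromℕ< (n%ℕd<d i k)

  residue-≋ : ∀ i → + toℕ (residue i) ≋ i
  residue-≋ i = subst (λ r → + r ≋ i) (sym (Fin.toℕ-fromℕ< (n%ℕd<d i k))) (%ℕ-≋ i)

  ≋⇒≡residue : ∀ {c i} → + toℕ c ≋ i → c ≡ residue i
  ≋⇒≡residue {i = i} c≋i = residue-unique (≋-trans c≋i (≋-sym (residue-≋ i)))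

  /ℕ-unique : ∀ {i} r q → r < k → i ≡ + r ℤ.+ q ℤ.* + k → i /ℕ k ≡ q
  /ℕ-unique {i} r q r<k i≡ = ℤ.*-cancelʳ-≡ (i /ℕ k) q (+ k) (∙-cancelˡ (+ r) _ _ (begin
    + r ℤ.+ i /ℕ k ℤ.* + k         ≡⟨ cong (λ r → + r ℤ.+ i /ℕ k ℤ.* + k) r≡ ⟩
    + (i %ℕ k) ℤ.+ i /ℕ k ℤ.* + k  ≡⟨ a≡a%ℕn+[a/ℕn]*n i k ⟨
    i                              ≡⟨ i≡ ⟩
    + r ℤ.+ q ℤ.* + k              ∎))
    where
    open ≡-Reasoning
    r≡ : r ≡ i %ℕ k
    r≡ = remainder-unique r<k (n%ℕd<d i k) (≋-trans (≋-remainder r q i≡) (≋-sym (%ℕ-≋ i)))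

  -- The quotient changes only when a multiple of `k` is left downwards. This makes the counting
  -- function `activations` jump at the active levels and nowhere else.
  /ℕ-pred : ∀ i → (i ≋ 0ℤ → (i ℤ.- 1ℤ) /ℕ k ≡ i /ℕ k ℤ.- 1ℤ) × (¬ i ≋ 0ℤ → (i ℤ.- 1ℤ) /ℕ k ≡ i /ℕ k)
  /ℕ-pred i with i %ℕ k | n%ℕd<d i k | a≡a%ℕn+[a/ℕn]*n i k
  -- With remainder 0, passing to `i - 1` borrows from the quotient and leaves remainder `k - 1`.
  ... | zero | _ | eq = (λ _ → /ℕ-unique (pred k) (i /ℕ k ℤ.- 1ℤ) (≤-reflexive (suc-pred k)) eq′)
                      , contradiction (≋-sym (≋-remainder 0 (i /ℕ k) eq))
    where
    rearrange : ∀ p q → 0ℤ ℤ.+ q ℤ.* (1ℤ ℤ.+ p) ℤ.- 1ℤ ≡ p ℤ.+ (q ℤ.- 1ℤ) ℤ.* (1ℤ ℤ.+ p)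
    rearrange = solve-∀
    eq′ : i ℤ.- 1ℤ ≡ + pred k ℤ.+ (i /ℕ k ℤ.- 1ℤ) ℤ.* + k
    eq′ = begin
      i ℤ.- 1ℤ
        ≡⟨ cong (ℤ._- 1ℤ) eq ⟩
      0ℤ ℤ.+ i /ℕ k ℤ.* + k ℤ.- 1ℤ
        ≡⟨ cong (λ d → 0ℤ ℤ.+ i /ℕ k ℤ.* + d ℤ.- 1ℤ) (suc-pred k) ⟨
      0ℤ ℤ.+ i /ℕ k ℤ.* (1ℤ ℤ.+ + pred k) ℤ.- 1ℤ
        ≡⟨ rearrange (+ pred k) (i /ℕ k) ⟩
      + pred k ℤ.+ (i /ℕ k ℤ.- 1ℤ) ℤ.* (1ℤ ℤ.+ + pred k)
        ≡⟨ cong (λ d → + pred k ℤ.+ (i /ℕ k ℤ.- 1ℤ) ℤ.* + d) (suc-pred k) ⟩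
      + pred k ℤ.+ (i /ℕ k ℤ.- 1ℤ) ℤ.* + k
        ∎
      where open ≡-Reasoning
  ... | suc r | r<k | eq =
      (λ i≋0 → contradiction (remainder-unique r<k (≤-<-trans z≤n r<k)
                               (≋-trans (≋-remainder (suc r) (i /ℕ k) eq) i≋0)) λ ())
    , (λ _ → /ℕ-unique r (i /ℕ k) (<⇒≤ r<k) (trans (cong (ℤ._- 1ℤ) eq) (rearrange (+ r) (i /ℕ k ℤ.* + k))))
    where
    rearrange : ∀ r a → (1ℤ ℤ.+ r) ℤ.+ a ℤ.- 1ℤ ≡ r ℤ.+ a
    rearrange = solve-∀

-- The sup metric on integer vectors and its boxes.

∣j-i∣-triangle : ∀ i j l → ∣ l ℤ.- i ∣ ≤ ∣ j ℤ.- i ∣ + ∣ l ℤ.- j ∣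
∣j-i∣-triangle i j l = subst (λ d → ∣ d ∣ ≤ ∣ j ℤ.- i ∣ + ∣ l ℤ.- j ∣) (sym (split i j l)) (ℤ.∣i+j∣≤∣i∣+∣j∣ (j ℤ.- i) (l ℤ.- j))
  where
  split : ∀ i j l → l ℤ.- i ≡ (j ℤ.- i) ℤ.+ (l ℤ.- j)
  split = solve-∀

lookup-ext : ∀ {A : Set} {n} {v w : Vec A n} → (∀ c → lookup v c ≡ lookup w c) → v ≡ w
lookup-ext {v = v} {w} eq =
  trans (sym (Vec.tabulate∘lookup v)) (trans (Vec.tabulate-cong eq) (Vec.tabulate∘lookup w))

length-cartesianProductWith : ∀ {A B C : Set} (f : A → B → C) xs ys →
  length (cartesianProductWith f xs ys) ≡ length xs * length ys
length-cartesianProductWith f []       ys = refl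
length-cartesianProductWith f (x ∷ xs) ys =
  trans (length-++ (map (f x) ys)) (cong₂ _+_ (length-map (f x) ys) (length-cartesianProductWith f xs ys))

interval : ℕ → ℤ → List ℤ
interval n x = map (λ j → (x ℤ.- + n) ℤ.+ + j) (upTo (suc (n + n)))

length-interval : ∀ n x → length (interval n x) ≡ suc (n + n)
length-interval n x = trans (length-map _ (upTo (suc (n + n)))) (length-upTo _)

interval-! : ∀ n x → Unique (interval n x)
interval-! n x = Unique.map⁺ (ℤ.+-injective ∘ ∙-cancelˡ (x ℤ.- + n) _ _) (Unique.upTo⁺ _)

∈-interval⁺ : ∀ {n x y} → ∣ y ℤ.- x ∣ ≤ n → y ∈ interval n x
∈-interval⁺ {n} {x} {y} ∣d∣≤n with offset (y ℤ.- x) ∣d∣≤n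
  where
  offset : ∀ d → ∣ d ∣ ≤ n → ∃[ j ] j ≤ n + n × d ≡ + j ℤ.- + n
  -- The position in the interval is `d + n`. It is nonnegative, so the absolute value merely turns
  -- it into a natural number.
  offset d ∣d∣≤n = ∣ d ℤ.+ + n ∣ , ≤-trans (ℤ.∣i+j∣≤∣i∣+∣j∣ d (+ n)) (+-monoˡ-≤ n ∣d∣≤n)
    , trans (rearrange d (+ n)) (cong (ℤ._- + n) (sym (ℤ.0≤i⇒+∣i∣≡i (0≤d+n d ∣d∣≤n))))
    where
    rearrange : ∀ d n → d ≡ (d ℤ.+ n) ℤ.- n
    rearrange = solve-∀
    0≤d+n : ∀ d → ∣ d ∣ ≤ n → 0ℤ ℤ.≤ d ℤ.+ + n
    0≤d+n (+ m)    _   = ℤ.+≤+ z≤n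
    0≤d+n -[1+ m ] m<n = subst (0ℤ ℤ.≤_) (sym (ℤ.⊖-≥ m<n)) (ℤ.+≤+ z≤n)
... | j , j≤n+n , eq =
  subst (_∈ interval n x) (trans (regroup x (+ n) (+ j)) (trans (cong (ℤ._+ x) (sym eq)) (recover x y)))
        (∈-map⁺ _ (∈-upTo⁺ (s≤s j≤n+n)))
  where
  regroup : ∀ x n j → (x ℤ.- n) ℤ.+ j ≡ (j ℤ.- n) ℤ.+ x
  regroup = solve-∀
  recover : ∀ x y → (y ℤ.- x) ℤ.+ x ≡ y
  recover = solve-∀

∈-interval⁻ : ∀ {n} x {y} → y ∈ interval n x → ∣ y ℤ.- x ∣ ≤ n
∈-interval⁻ {n} x y∈ with ∈-map⁻ _ y∈
... | j , j∈ , refl = subst (λ d → ∣ d ∣ ≤ n) (sym (regroup x (+ n) (+ j)))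
                        (subst (λ d → ∣ d ∣ ≤ n) (sym (ℤ.m-n≡m⊖n j n)) ∣j⊖n∣≤n)
  where
  regroup : ∀ x n j → (x ℤ.- n ℤ.+ j) ℤ.- x ≡ j ℤ.- n
  regroup = solve-∀
  ∣j⊖n∣≤n : ∣ j ℤ.⊖ n ∣ ≤ n
  ∣j⊖n∣≤n with ≤-total n j
  ... | inj₁ n≤j = subst (λ d → ∣ d ∣ ≤ n) (sym (ℤ.⊖-≥ n≤j)) (m≤n+o⇒m∸n≤o j n (≤-pred (∈-upTo⁻ j∈)))
  ... | inj₂ j≤n = subst (_≤ n) (sym (ℤ.∣⊖∣-≤ j≤n)) (m∸n≤m n j)

intervals : ∀ {k} → ℕ → Vec ℤ k → List (Vec ℤ k)
intervals n []      = [] ∷ []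
intervals n (x ∷ v) = cartesianProductWith _∷_ (interval n x) (intervals n v)

length-intervals : ∀ {k} n (v : Vec ℤ k) → length (intervals n v) ≡ suc (n + n) ^ k
length-intervals n []      = refl
length-intervals n (x ∷ v) = trans (length-cartesianProductWith _∷_ (interval n x) (intervals n v))
                                   (cong₂ _*_ (length-interval n x) (length-intervals n v))

intervals-! : ∀ {k} n (v : Vec ℤ k) → Unique (intervals n v)
intervals-! n []      = All.[] ∷ []
intervals-! n (x ∷ v) =
  Unique.cartesianProductWith⁺ _∷_ Vec.∷-injective (interval-! n x) (intervals-! n v)

∈-intervals⁺ : ∀ {k n} (v w : Vec ℤ k) →
  (∀ c → ∣ lookup w c ℤ.- lookup v c ∣ ≤ n) → w ∈ intervals n v
∈-intervals⁺ []      []      _     = here refl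
∈-intervals⁺ (x ∷ v) (y ∷ w) close =
  ∈-cartesianProductWith⁺ _∷_ (∈-interval⁺ (close zero)) (∈-intervals⁺ v w (close ∘ suc))

∈-intervals⁻ : ∀ {k n} (v : Vec ℤ k) {w} →
  w ∈ intervals n v → ∀ c → ∣ lookup w c ℤ.- lookup v c ∣ ≤ n
∈-intervals⁻ {n = n} (x ∷ v) w∈ c with ∈-cartesianProductWith⁻ _∷_ (interval n x) (intervals n v) w∈
∈-intervals⁻ (x ∷ v) w∈ zero    | _ , _ , y∈ , _  , refl = ∈-interval⁻ x y∈
∈-intervals⁻ (x ∷ v) w∈ (suc c) | _ , _ , _  , w∈′ , refl = ∈-intervals⁻ v w∈′ c

module _ {k : ℕ} where

  dist : ℤ × Vec ℤ k → ℤ × Vec ℤ k → ℕ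
  dist (i , v) (j , w) = ∣ j ℤ.- i ∣ ⊔ supremum (λ c → ∣ lookup w c ℤ.- lookup v c ∣)

  dist-lub : ∀ {n} u w → ∣ proj₁ w ℤ.- proj₁ u ∣ ≤ n →
    (∀ c → ∣ lookup (proj₂ w) c ℤ.- lookup (proj₂ u) c ∣ ≤ n) → dist u w ≤ n
  dist-lub u w level≤ coords≤ = ⊔-lub level≤ (supremum-lub coords≤)

  dist-level : ∀ u w → ∣ proj₁ w ℤ.- proj₁ u ∣ ≤ dist u w
  dist-level u w = m≤m⊔n ∣ proj₁ w ℤ.- proj₁ u ∣ _

  dist-coord : ∀ u w c → ∣ lookup (proj₂ w) c ℤ.- lookup (proj₂ u) c ∣ ≤ dist u w
  dist-coord u w c = ≤-trans (≤-supremum (λ c → ∣ lookup (proj₂ w) c ℤ.- lookup (proj₂ u) c ∣) c) (m≤n⊔m ∣ proj₁ w ℤ.- proj₁ u ∣ _)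

  dist-refl : ∀ (u : ℤ × Vec ℤ k) → dist u u ≤ 0
  dist-refl u = dist-lub u u (zero-distance (proj₁ u)) (λ c → zero-distance (lookup (proj₂ u) c))
    where
    zero-distance : ∀ x → ∣ x ℤ.- x ∣ ≤ 0
    zero-distance x = ≤-reflexive (cong ∣_∣ (ℤ.+-inverseʳ x))

  dist-sym : ∀ (u w : ℤ × Vec ℤ k) → dist w u ≤ dist u w
  dist-sym u w = dist-lub w u (≤-trans (≤-reflexive (ℤ.∣i-j∣≡∣j-i∣ (proj₁ u) (proj₁ w))) (dist-level u w))
    λ c → ≤-trans (≤-reflexive (ℤ.∣i-j∣≡∣j-i∣ (lookup (proj₂ u) c) (lookup (proj₂ w) c))) (dist-coord u w c)

  dist-triangle : ∀ u v w → dist u w ≤ dist u v + dist v w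
  dist-triangle u v w = dist-lub u w
    (≤-trans (∣j-i∣-triangle (proj₁ u) (proj₁ v) (proj₁ w)) (+-mono-≤ (dist-level u v) (dist-level v w)))
    λ c → ≤-trans (∣j-i∣-triangle (lookup (proj₂ u) c) (lookup (proj₂ v) c) (lookup (proj₂ w) c))
                  (+-mono-≤ (dist-coord u v c) (dist-coord v w c))

  box : ℕ → ℤ × Vec ℤ k → List (ℤ × Vec ℤ k)
  box n (i , v) = cartesianProduct (interval n i) (intervals n v)

  length-box : ∀ n u → length (box n u) ≡ suc (n + n) ^ suc k
  length-box n (i , v) = trans (length-cartesianProductWith _,_ (interval n i) (intervals n v))
                               (cong₂ _*_ (length-interval n i) (length-intervals n v))

  box-! : ∀ n u → Unique (box n u)
  box-! n (i , v) = Unique.cartesianProduct⁺ (interval-! n i) (intervals-! n v)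

  ∈-box⁺ : ∀ {n u w} → dist u w ≤ n → w ∈ box n u
  ∈-box⁺ {u = u} {w} d≤n = ∈-cartesianProduct⁺
    (∈-interval⁺ (≤-trans (dist-level u w) d≤n)) (∈-intervals⁺ (proj₂ u) (proj₂ w) λ c → ≤-trans (dist-coord u w c) d≤n)

  ∈-box⁻ : ∀ {n u w} → w ∈ box n u → dist u w ≤ n
  ∈-box⁻ {n} {i , v} {w} w∈ with ∈-cartesianProduct⁻ (interval n i) (intervals n v) w∈
  ... | i∈ , v∈ = dist-lub (i , v) w (∈-interval⁻ i i∈) (∈-intervals⁻ v v∈)

-- Arcs, walks and distances in the digraph.

module Graph (k : ℕ) .{{_ : NonZero k}} where
  open Residues k

  Γ : Digraph
  Γ = ℤ[ Θ∞ , k ]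

  open Digraph Γ using (Arc; Adjacent)

  private variable
    P : Pred (Vertex Γ) 0ℓ

  _≟ᵥ_ : DecidableEquality (Vertex Γ)
  _≟ᵥ_ = Product.≡-dec ℤ._≟_ (Vec.≡-dec ℤ._≟_)

  arc? : ∀ u w → Dec (Arc u w)
  arc? (i , v) (j , w) = (j ℤ.≟ i ℤ.+ 1ℤ) ×-dec Fin.all? λ c →
    let active? = k ℕ.∣? ∣ + toℕ c ℤ.- i ∣ in
    (¬? active? →-dec (lookup v c ℤ.≟ lookup w c)) ×-dec
    (active? →-dec ((lookup w c ℤ.≟ lookup v c) ⊎-dec (lookup w c ℤ.≟ lookup v c ℤ.+ 1ℤ)))

  adjacent? : ∀ u w → Dec (Adjacent u w)
  adjacent? u w = arc? u w ⊎-dec arc? w u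

  arc-level : ∀ u w → Arc u w → proj₁ w ≡ proj₁ u ℤ.+ 1ℤ
  arc-level _ _ = proj₁

  arc-idle : ∀ u w → Arc u w → ∀ c → ¬ + toℕ c ≋ proj₁ u → lookup (proj₂ w) c ≡ lookup (proj₂ u) c
  arc-idle u w a c c≢i = sym (proj₁ (proj₂ a c) (c≢i ∘ congruent))

  arc-active : ∀ u w → Arc u w → ∀ c → + toℕ c ≋ proj₁ u →
    Digraph.Arc Θ∞ (lookup (proj₂ u) c) (lookup (proj₂ w) c)
  arc-active u w a c c≡i = proj₂ (proj₂ a c) (divisible c≡i)

  arc-coord : ∀ u w → Arc u w → ∀ c → Digraph.Arc Θ∞ (lookup (proj₂ u) c) (lookup (proj₂ w) c)
  arc-coord u w a c with + toℕ c ≋? proj₁ u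
  ... | yes c≡i = arc-active u w a c c≡i
  ... | no  c≢i = inj₁ (arc-idle u w a c c≢i)

  mkArc : ∀ u w → proj₁ w ≡ proj₁ u ℤ.+ 1ℤ →
    (∀ c → ¬ + toℕ c ≋ proj₁ u → lookup (proj₂ w) c ≡ lookup (proj₂ u) c) →
    (∀ c → + toℕ c ≋ proj₁ u → Digraph.Arc Θ∞ (lookup (proj₂ u) c) (lookup (proj₂ w) c)) → Arc u w
  mkArc u w level idle active = level , λ c → (λ c≢i → sym (idle c (c≢i ∘ divisible))) , (active c ∘ congruent)

  -- The loops of `Θ∞` let the active coordinate stay too, so the level can be raised with all
  -- coordinates fixed.
  idle-arc : ∀ {i j} v → j ≡ i ℤ.+ 1ℤ → Arc (i , v) (j , v)
  idle-arc {i} {j} v j≡i+1 = mkArc (i , v) (j , v) j≡i+1 (λ _ _ → refl) (λ _ _ → inj₁ refl)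

  -- Both ends are updates of the same `v`, so that successive increments compose and only the entry
  -- at `c` has to be tracked.
  increment-arc : ∀ {i j} v c x → j ≡ i ℤ.+ 1ℤ → + toℕ c ≋ i →
    Arc (i , v [ c ]≔ x) (j , v [ c ]≔ (x ℤ.+ 1ℤ))
  increment-arc {i} {j} v c x j≡i+1 c≋i = mkArc (i , v [ c ]≔ x) (j , v [ c ]≔ (x ℤ.+ 1ℤ)) j≡i+1 idle active
    where
    idle : ∀ d → ¬ + toℕ d ≋ i → lookup (v [ c ]≔ (x ℤ.+ 1ℤ)) d ≡ lookup (v [ c ]≔ x) d
    idle d d≢i = trans (Vec.lookup∘update′ d≢c v _) (sym (Vec.lookup∘update′ d≢c v _))
      where d≢c : d ≢ c
            d≢c refl = d≢i c≋i
    active : ∀ d → + toℕ d ≋ i → Digraph.Arc Θ∞ (lookup (v [ c ]≔ x) d) (lookup (v [ c ]≔ (x ℤ.+ 1ℤ)) d)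
    active d d≋i with residue-unique (≋-trans d≋i (≋-sym c≋i))
    ... | refl = inj₂ (trans (Vec.lookup∘update d v _) (cong (ℤ._+ 1ℤ) (sym (Vec.lookup∘update d v x))))

  arc⇒dist≤1 : ∀ u w → Arc u w → dist u w ≤ 1
  arc⇒dist≤1 u w a = dist-lub u w (distance (inj₂ (arc-level u w a))) (distance ∘ arc-coord u w a)
    where
    difference : ∀ x → (x ℤ.+ 1ℤ) ℤ.- x ≡ 1ℤ
    difference = solve-∀
    distance : ∀ {x y} → Digraph.Arc Θ∞ x y → ∣ y ℤ.- x ∣ ≤ 1
    distance {x} (inj₁ refl) = subst (λ d → ∣ d ∣ ≤ 1) (sym (ℤ.+-inverseʳ x)) z≤n
    distance {x} (inj₂ refl) = ≤-reflexive (cong ∣_∣ (difference x))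

  adjacent⇒dist≤1 : ∀ u w → Adjacent u w → dist u w ≤ 1
  adjacent⇒dist≤1 u w (inj₁ a) = arc⇒dist≤1 u w a
  adjacent⇒dist≤1 u w (inj₂ a) = ≤-trans (dist-sym w u) (arc⇒dist≤1 w u a)

  walk⇒dist≤ : ∀ {n u w} → Walk Γ P n u w → dist u w ≤ n
  walk⇒dist≤ {u = u}     (nil _)        = ≤-trans (dist-refl u) z≤n
  walk⇒dist≤ {u = u} {w} (cons {v = v} _ a walk) =
    ≤-trans (dist-triangle u v w) (+-mono-≤ (adjacent⇒dist≤1 u v a) (walk⇒dist≤ walk))

  forward : ∀ {i v} n → (∀ l → l ≤ n → P (i ℤ.+ + l , v)) → Walk Γ P n (i , v) (i ℤ.+ + n , v)
  forward {P = P} {i} {v} zero    inP =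
    subst (λ j → Walk Γ P 0 (j , v) (i ℤ.+ 0ℤ , v)) (ℤ.+-identityʳ i) (nil (inP 0 z≤n))
  forward {i = i} {v} (suc n) inP = snoc (forward n (λ l l≤n → inP l (m≤n⇒m≤1+n l≤n)))
    (inj₁ (idle-arc {i ℤ.+ + n} v (next i (+ n)))) (inP (suc n) ≤-refl)
    where
    next : ∀ i n → i ℤ.+ (1ℤ ℤ.+ n) ≡ i ℤ.+ n ℤ.+ 1ℤ
    next = solve-∀

  horizontal : ∀ {v} → (∀ l → P (l , v)) → ∀ i j → Walk Γ P ∣ j ℤ.- i ∣ (i , v) (j , v)
  horizontal {P = P} {v} inP i j with j ℤ.- i in eq
  ... | + n      = subst (λ j → Walk Γ P n (i , v) (j , v)) (trans (cong (ℤ._+_ i) (sym eq)) (recover i j))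
                     (forward n λ l _ → inP (i ℤ.+ + l))
    where
    recover : ∀ i j → i ℤ.+ (j ℤ.- i) ≡ j
    recover = solve-∀
  ... | -[1+ n ] = subst (λ i → Walk Γ P (suc n) (i , v) (j , v)) (trans (cong (λ d → j ℤ.- d) (sym eq)) (recover i j))
                     (reverse (forward (suc n) λ l _ → inP (j ℤ.+ + l)))
    where
    recover : ∀ i j → j ℤ.- (j ℤ.- i) ≡ i
    recover = solve-∀

  module _ {P : Pred (Vertex Γ) 0ℓ} {i : ℤ} (inP : ∀ l → l ≤ k → ∀ v → P (i ℤ.+ + l , v)) where

    -- Climb with `c` fixed to the first level from `i` on at which `c` is active, raise `c` in the
    -- step leaving it, and descend with the new value. Each half has at most `k` steps and stays in
    -- the levels from `i` to `i + k`.
    increment : ∀ v c x → Walk Γ P (k + k) (i , v [ c ]≔ x) (i , v [ c ]≔ (x ℤ.+ 1ℤ))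
    increment v c x = append
      (weaken n<k (snoc (forward n λ l l≤n → inP l (≤-trans l≤n (<⇒≤ n<k)) _)
                        (inj₁ (increment-arc {i ℤ.+ + n} v c x (next i (+ n)) c≋i+n))
                        (inP (suc n) n<k _)))
      (reverse (weaken n<k (forward (suc n) λ l l≤n → inP l (≤-trans l≤n n<k) _)))
      where
      -- The least `n` for which `c` is active at level `i + n`.
      n = toℕ (residue (+ toℕ c ℤ.- i))
      n<k : n < k
      n<k = Fin.toℕ<n (residue (+ toℕ c ℤ.- i))
      next : ∀ i n → i ℤ.+ (1ℤ ℤ.+ n) ≡ i ℤ.+ n ℤ.+ 1ℤ
      next = solve-∀
      recover : ∀ c i → c ℤ.- i ℤ.+ i ≡ c
      recover = solve-∀
      c≋i+n : + toℕ c ≋ i ℤ.+ + n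
      c≋i+n = ≋-sym (subst₂ _≋_ (ℤ.+-comm (+ n) i) (recover (+ toℕ c) i) (≋-+ʳ i (residue-≋ (+ toℕ c ℤ.- i))))

    inP₀ : ∀ v → P (i , v)
    inP₀ v = subst (λ j → P (j , v)) (ℤ.+-identityʳ i) (inP 0 z≤n v)

    add : ∀ n v c x → Walk Γ P (n * (k + k)) (i , v [ c ]≔ x) (i , v [ c ]≔ (x ℤ.+ + n))
    add zero    v c x = subst (λ y → Walk Γ P 0 (i , v [ c ]≔ x) (i , v [ c ]≔ y)) (sym (ℤ.+-identityʳ x))
                          (nil (inP₀ _))
    add (suc n) v c x = subst (λ y → Walk Γ P (suc n * (k + k)) (i , v [ c ]≔ x) (i , v [ c ]≔ y))
                          (ℤ.+-assoc x 1ℤ (+ n)) (append (increment v c x) (add n v c (x ℤ.+ 1ℤ)))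

    replace : ∀ {n} v c x → ∣ x ℤ.- lookup v c ∣ ≤ n → Walk Γ P (n * (k + k)) (i , v) (i , v [ c ]≔ x)
    replace {n} v c x d≤n = weaken (*-monoˡ-≤ (k + k) d≤n)
      -- Writing `v` as its own update at `c` brings both ends into the form that `add` handles. A
      -- negative difference is treated by reversing an addition.
      (subst (λ w → Walk Γ P (∣ x ℤ.- lookup v c ∣ * (k + k)) (i , w) (i , v [ c ]≔ x)) (Vec.[]≔-lookup v c) (directed (lookup v c)))
      where
      recover : ∀ x y → x ℤ.+ (y ℤ.- x) ≡ y
      recover = solve-∀
      recover′ : ∀ x y → y ℤ.- (y ℤ.- x) ≡ x
      recover′ = solve-∀
      directed : ∀ y → Walk Γ P (∣ x ℤ.- y ∣ * (k + k)) (i , v [ c ]≔ y) (i , v [ c ]≔ x)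
      directed y with x ℤ.- y in eq
      ... | + n      = subst (λ z → Walk Γ P (n * (k + k)) (i , v [ c ]≔ y) (i , v [ c ]≔ z))
                         (trans (cong (ℤ._+_ y) (sym eq)) (recover y x)) (add n v c y)
      ... | -[1+ n ] = subst (λ z → Walk Γ P (suc n * (k + k)) (i , v [ c ]≔ z) (i , v [ c ]≔ x))
                         (trans (cong (ℤ._-_ x) (sym eq)) (recover′ y x)) (reverse (add (suc n) v c x))

    vertical : ∀ {n} v w → (∀ c → ∣ lookup w c ℤ.- lookup v c ∣ ≤ n) →
      Walk Γ P (k * (n * (k + k))) (i , v) (i , w)
    vertical {n} = assemble (i ,_) inP₀ replace
      where
      -- The coordinates are replaced one after the other. The map `f` holds the level and the
      -- coordinates already replaced, so the recursion runs over the remaining ones.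
      assemble : ∀ {m b} (f : Vec ℤ m → Vertex Γ) → (∀ v → P (f v)) →
        (∀ v c x → ∣ x ℤ.- lookup v c ∣ ≤ n → Walk Γ P b (f v) (f (v [ c ]≔ x))) →
        ∀ v w → (∀ c → ∣ lookup w c ℤ.- lookup v c ∣ ≤ n) → Walk Γ P (m * b) (f v) (f w)
      assemble f inP walk []      []      _     = nil (inP [])
      assemble f inP walk (x ∷ v) (y ∷ w) close = append
        (walk (x ∷ v) zero y (close zero))
        (assemble (f ∘ (y ∷_)) (inP ∘ (y ∷_)) (λ v c → walk (y ∷ v) (suc c)) v w (close ∘ suc))

  -- At distance `n`, at most `n` steps correct the level, and each of the `k` coordinates needs at
  -- most `n` unit changes of `2k` steps each; the total is `stretch * n`.
  stretch : ℕ
  stretch = 1 + k * (k + k)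

  dist≤⇒walk : ∀ {n} u w → dist u w ≤ n → Walk Γ (const ⊤) (stretch * n) u w
  dist≤⇒walk {n} u@(i , v) w@(j , w′) d≤n = subst (λ m → Walk Γ (const ⊤) m u w) (length≡ n k)
    (append (weaken (≤-trans (dist-level u w) d≤n) (horizontal (λ _ → tt) i j))
            (vertical (λ _ _ _ → tt) v w′ λ c → ≤-trans (dist-coord u w c) d≤n))
    where
    length≡ : ∀ n k → n + k * (n * (k + k)) ≡ (1 + k * (k + k)) * n
    length≡ = ℕ.solve-∀

  connected : Connected Γ
  connected u w with walk⇒path _≟ᵥ_ (dist≤⇒walk u w ≤-refl)
  ... | n , _ , p , joins , _ = n , p , joins

  ball⊆box : ∀ {n u w} → Walk Γ P n u w → w ∈ box n u
  ball⊆box {u = u} {w} = ∈-box⁺ {u = u} {w} ∘ walk⇒dist≤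

  ball? : ∀ n u w → Dec (Walk Γ (const ⊤) n u w)
  ball? = walk? _≟ᵥ_ (box 1) adjacent? (λ {u} {w} → ∈-box⁺ {u = u} {w} ∘ adjacent⇒dist≤1 u w)

-- Natural numbers as rationals, and bounds for polynomials.

-- Replaces the normalised fraction by one with denominator 1, so that the facts about `fromNat`
-- below reduce to facts about integers.
toℚᵘ-fromNat : ∀ n → ℚ.toℚᵘ (fromNat n) ℚᵘ.≃ mkℚᵘ (+ n) 0
toℚᵘ-fromNat n = ℚ.toℚᵘ-fromℚᵘ (mkℚᵘ (+ n) 0)

fromNat-+ : ∀ m n → fromNat (m + n) ≡ fromNat m ℚ.+ fromNat n
fromNat-+ m n = ℚ.toℚᵘ-injective (begin-equality
  ℚ.toℚᵘ (fromNat (m + n))                         ≃⟨ toℚᵘ-fromNat (m + n) ⟩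
  mkℚᵘ (+ (m + n)) 0                               ≃⟨ *≡* (cong (λ i → i ℤ.* + 1) (sym (cong₂ ℤ._+_ (ℤ.*-identityʳ (+ m)) (ℤ.*-identityʳ (+ n))))) ⟩
  mkℚᵘ (+ m) 0 ℚᵘ.+ mkℚᵘ (+ n) 0                   ≃⟨ ℚᵘ.+-cong (toℚᵘ-fromNat m) (toℚᵘ-fromNat n) ⟨
  ℚ.toℚᵘ (fromNat m) ℚᵘ.+ ℚ.toℚᵘ (fromNat n)       ≃⟨ ℚ.toℚᵘ-homo-+ (fromNat m) (fromNat n) ⟨
  ℚ.toℚᵘ (fromNat m ℚ.+ fromNat n)                 ∎)
  where open ℚᵘ.≤-Reasoning

fromNat-* : ∀ m n → fromNat (m * n) ≡ fromNat m ℚ.* fromNat n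
fromNat-* m n = ℚ.toℚᵘ-injective (begin-equality
  ℚ.toℚᵘ (fromNat (m * n))                         ≃⟨ toℚᵘ-fromNat (m * n) ⟩
  mkℚᵘ (+ (m * n)) 0                               ≃⟨ *≡* (cong (λ i → i ℤ.* + 1) (ℤ.pos-* m n)) ⟩
  mkℚᵘ (+ m) 0 ℚᵘ.* mkℚᵘ (+ n) 0                   ≃⟨ ℚᵘ.*-cong (toℚᵘ-fromNat m) (toℚᵘ-fromNat n) ⟨
  ℚ.toℚᵘ (fromNat m) ℚᵘ.* ℚ.toℚᵘ (fromNat n)       ≃⟨ ℚ.toℚᵘ-homo-* (fromNat m) (fromNat n) ⟨
  ℚ.toℚᵘ (fromNat m ℚ.* fromNat n)                 ∎)
  where open ℚᵘ.≤-Reasoning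

fromNat-mono-≤ : ∀ {m n} → m ≤ n → fromNat m ℚ.≤ fromNat n
fromNat-mono-≤ {m} {n} m≤n = ℚ.toℚᵘ-cancel-≤ (begin
  ℚ.toℚᵘ (fromNat m)  ≃⟨ toℚᵘ-fromNat m ⟩
  mkℚᵘ (+ m) 0        ≤⟨ *≤* (ℤ.*-monoʳ-≤-nonNeg (+ 1) (ℤ.+≤+ m≤n)) ⟩
  mkℚᵘ (+ n) 0        ≃⟨ toℚᵘ-fromNat n ⟨
  ℚ.toℚᵘ (fromNat n)  ∎)
  where open ℚᵘ.≤-Reasoning

fromNat-cancel-≤ : ∀ {m n} → fromNat m ℚ.≤ fromNat n → m ≤ n
fromNat-cancel-≤ {m} {n} le = ℤ.drop‿+≤+ (ℤ.*-cancelʳ-≤-pos (+ m) (+ n) (+ 1) (ℚᵘ.drop-*≤* (begin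
  mkℚᵘ (+ m) 0        ≃⟨ toℚᵘ-fromNat m ⟨
  ℚ.toℚᵘ (fromNat m)  ≤⟨ ℚ.toℚᵘ-mono-≤ le ⟩
  ℚ.toℚᵘ (fromNat n)  ≃⟨ toℚᵘ-fromNat n ⟩
  mkℚᵘ (+ n) 0        ∎)))
  where open ℚᵘ.≤-Reasoning

-- The absolute value of the numerator is large enough, since the denominator is at least 1.
≤-fromNat : ∀ q → ∃[ n ] q ℚ.≤ fromNat n
≤-fromNat q@(mkℚ i d _) = ℤ.∣ i ∣ , ℚ.toℚᵘ-cancel-≤ (begin
  mkℚᵘ i d                    ≤⟨ *≤* (numerator i) ⟩
  mkℚᵘ (+ ℤ.∣ i ∣) 0          ≃⟨ toℚᵘ-fromNat ℤ.∣ i ∣ ⟨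
  ℚ.toℚᵘ (fromNat ℤ.∣ i ∣)    ∎)
  where
  open ℚᵘ.≤-Reasoning
  numerator : ∀ i → i ℤ.* + 1 ℤ.≤ + ℤ.∣ i ∣ ℤ.* + suc d
  numerator (+ n)    = subst₂ ℤ._≤_ (ℤ.pos-* n 1) (ℤ.pos-* n (suc d)) (ℤ.+≤+ (*-monoʳ-≤ n (s≤s z≤n)))
  numerator -[1+ n ] = ℤ.-≤+

monomial : ℕ → ℕ → Polynomial
monomial zero    c = fromNat c ∷ []
monomial (suc d) c = 0ℚ ∷ monomial d c

eval-monomial : ∀ d c x → eval (monomial d c) (fromNat x) ≡ fromNat (x ^ d * c)
eval-monomial zero    c x = trans (cong (fromNat c ℚ.+_) (ℚ.*-zeroʳ (fromNat x)))
                           (trans (ℚ.+-identityʳ (fromNat c)) (cong fromNat (sym (*-identityˡ c))))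
eval-monomial (suc d) c x = begin
  0ℚ ℚ.+ fromNat x ℚ.* eval (monomial d c) (fromNat x)  ≡⟨ ℚ.+-identityˡ _ ⟩
  fromNat x ℚ.* eval (monomial d c) (fromNat x)         ≡⟨ cong (fromNat x ℚ.*_) (eval-monomial d c x) ⟩
  fromNat x ℚ.* fromNat (x ^ d * c)                     ≡⟨ fromNat-* x (x ^ d * c) ⟨
  fromNat (x * (x ^ d * c))                             ≡⟨ cong fromNat (*-assoc x (x ^ d) c) ⟨
  fromNat (x ^ suc d * c)                               ∎
  where open ≡-Reasoning

coefficient-monomial : ∀ d c → coefficient (monomial d c) d ≡ fromNat c
coefficient-monomial zero    c = refl
coefficient-monomial (suc d) c = coefficient-monomial d c

coefficient-monomial-> : ∀ d c i → d < i → coefficient (monomial d c) i ≡ 0ℚ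
coefficient-monomial-> zero    c (suc i) _         = refl
coefficient-monomial-> (suc d) c (suc i) (s≤s d<i) = coefficient-monomial-> d c i d<i

-- Since trailing zeros are allowed, a list with vanishing coefficients may be nonempty, and its
-- value has to be computed.
eval-zero : ∀ p x → (∀ i → coefficient p i ≡ 0ℚ) → eval p x ≡ 0ℚ
eval-zero []      x _  = refl
eval-zero (a ∷ p) x p≡0 = begin
  a ℚ.+ x ℚ.* eval p x   ≡⟨ cong₂ (λ a b → a ℚ.+ x ℚ.* b) (p≡0 0) (eval-zero p x (p≡0 ∘ suc)) ⟩
  0ℚ ℚ.+ x ℚ.* 0ℚ        ≡⟨ ℚ.+-identityˡ _ ⟩
  x ℚ.* 0ℚ               ≡⟨ ℚ.*-zeroʳ x ⟩
  0ℚ                     ∎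
  where open ≡-Reasoning

-- The constant adds up natural upper bounds for the coefficients. For `1 ≤ x` the lower powers of
-- `x` are absorbed by the top one.
eval-bounded : ∀ d p → (∀ i → d < i → coefficient p i ≡ 0ℚ) →
  ∃[ c ] ∀ x → 1 ≤ x → eval p (fromNat x) ℚ.≤ fromNat (c * x ^ d)
eval-bounded d       []      _    = 0 , λ x _ → ℚ.≤-refl
eval-bounded zero    (a ∷ p) high with ≤-fromNat a
... | c , a≤c = c , λ x _ → (begin
  a ℚ.+ fromNat x ℚ.* eval p (fromNat x)  ≡⟨ cong (λ b → a ℚ.+ fromNat x ℚ.* b) (eval-zero p (fromNat x) (λ i → high (suc i) (s≤s z≤n))) ⟩
  a ℚ.+ fromNat x ℚ.* 0ℚ                  ≡⟨ cong (a ℚ.+_) (ℚ.*-zeroʳ (fromNat x)) ⟩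
  a ℚ.+ 0ℚ                                ≡⟨ ℚ.+-identityʳ a ⟩
  a                                       ≤⟨ a≤c ⟩
  fromNat c                               ≡⟨ cong fromNat (*-identityʳ c) ⟨
  fromNat (c * 1)                         ∎)
  where open ℚ.≤-Reasoning
eval-bounded (suc d) (a ∷ p) high with ≤-fromNat a | eval-bounded d p (λ i d<i → high (suc i) (s≤s d<i))
... | b , a≤b | c , p≤c = b + c , bound
  where
  open ℚ.≤-Reasoning
  regroup : ∀ b c x y → b * (x * y) + x * (c * y) ≡ (b + c) * (x * y)
  regroup = ℕ.solve-∀
  bound : ∀ x → 1 ≤ x → eval (a ∷ p) (fromNat x) ℚ.≤ fromNat ((b + c) * x ^ suc d)
  bound x@(suc _) 1≤x = begin
    a ℚ.+ fromNat x ℚ.* eval p (fromNat x)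
      ≤⟨ ℚ.+-mono-≤ a≤b (ℚ.*-monoˡ-≤-nonNeg (fromNat x) {{ℚ.nonNegative (fromNat-mono-≤ {0} {x} z≤n)}} (p≤c x 1≤x)) ⟩
    fromNat b ℚ.+ fromNat x ℚ.* fromNat (c * x ^ d)
      ≤⟨ ℚ.+-monoˡ-≤ _ (fromNat-mono-≤ (m≤m*n b (x ^ suc d) {{m^n≢0 x (suc d)}})) ⟩
    fromNat (b * x ^ suc d) ℚ.+ fromNat x ℚ.* fromNat (c * x ^ d)
      ≡⟨ cong (fromNat (b * x ^ suc d) ℚ.+_) (fromNat-* x (c * x ^ d)) ⟨
    fromNat (b * x ^ suc d) ℚ.+ fromNat (x * (c * x ^ d))
      ≡⟨ fromNat-+ (b * x ^ suc d) (x * (c * x ^ d)) ⟨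
    fromNat (b * x ^ suc d + x * (c * x ^ d))
      ≡⟨ cong fromNat (regroup b c x (x ^ d)) ⟩
    fromNat ((b + c) * x ^ suc d)
      ∎

^-distribʳ-* : ∀ m n d → (m * n) ^ d ≡ m ^ d * n ^ d
^-distribʳ-* m n zero    = refl
^-distribʳ-* m n (suc d) = trans (cong (m * n *_) (^-distribʳ-* m n d)) (interchange m n (m ^ d) (n ^ d))
  where
  interchange : ∀ a b c d → a * b * (c * d) ≡ a * c * (b * d)
  interchange = ℕ.solve-∀

-- For positive `n` one has `2n + 1 ≤ 3n`; the summand 1 takes care of `n = 0`.
power-bound : ∀ n d → suc (n + n) ^ d ≤ 1 + n ^ d * 3 ^ d
power-bound zero    d = ≤-trans (≤-reflexive (^-zeroˡ d)) (s≤s z≤n)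
power-bound n@(suc m) d = begin
  suc (n + n) ^ d      ≤⟨ ^-monoˡ-≤ d (≤-trans (+-monoˡ-≤ (n + n) (s≤s z≤n)) (≤-reflexive (triple n))) ⟩
  (n * 3) ^ d          ≡⟨ ^-distribʳ-* n 3 d ⟩
  n ^ d * 3 ^ d        ≤⟨ n≤1+n _ ⟩
  1 + n ^ d * 3 ^ d    ∎
  where
  open ≤-Reasoning
  triple : ∀ n → n + (n + n) ≡ n * 3
  triple = ℕ.solve-∀

-- Polynomial growth of degree `k + 1`.

module Growth (k : ℕ) .{{_ : NonZero k}} where
  open Graph k

  -- Chosen to match `power-bound` with exponent `k + 1`. The constant term in front moves the
  -- monomial of degree `k` up by one degree.
  boundingPolynomial : Polynomial
  boundingPolynomial = fromNat 1 ∷ monomial k (3 ^ suc k)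

  boundingPolynomial-degree : HasDegree boundingPolynomial (suc k)
  boundingPolynomial-degree = leading , λ { (suc i) (s≤s k<i) → coefficient-monomial-> k _ i k<i }
    where
    leading : coefficient (monomial k (3 ^ suc k)) k ≢ 0ℚ
    leading eq = <⇒≱ (m^n>0 3 (suc k))
      (fromNat-cancel-≤ (ℚ.≤-reflexive (trans (sym (coefficient-monomial k (3 ^ suc k))) eq)))

  eval-boundingPolynomial : ∀ n → eval boundingPolynomial (fromNat n) ≡ fromNat (1 + n ^ suc k * 3 ^ suc k)
  eval-boundingPolynomial n = begin
    fromNat 1 ℚ.+ fromNat n ℚ.* eval (monomial k c) (fromNat n)  ≡⟨ cong (λ b → fromNat 1 ℚ.+ fromNat n ℚ.* b) (eval-monomial k c n) ⟩
    fromNat 1 ℚ.+ fromNat n ℚ.* fromNat (n ^ k * c)              ≡⟨ cong (fromNat 1 ℚ.+_) (fromNat-* n (n ^ k * c)) ⟨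
    fromNat 1 ℚ.+ fromNat (n * (n ^ k * c))                      ≡⟨ fromNat-+ 1 (n * (n ^ k * c)) ⟨
    fromNat (1 + n * (n ^ k * c))                                ≡⟨ cong (λ b → fromNat (1 + b)) (*-assoc n (n ^ k) c) ⟨
    fromNat (1 + n ^ suc k * c)                                  ∎
    where
    open ≡-Reasoning
    c = 3 ^ suc k

  growthBounded : ∀ u → GrowthBoundedBy Γ u boundingPolynomial
  growthBounded u n = length ball , (ball , Unique.filter⁺ (ball? n u) (box-! n u) , ∈-ball , refl) , (begin
    fromNat (length ball)                      ≤⟨ fromNat-mono-≤ (≤-trans (length-filter (ball? n u) (box n u)) (≤-reflexive (length-box n u))) ⟩
    fromNat (suc (n + n) ^ suc k)              ≤⟨ fromNat-mono-≤ (power-bound n (suc k)) ⟩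
    fromNat (1 + n ^ suc k * 3 ^ suc k)        ≡⟨ eval-boundingPolynomial n ⟨
    eval boundingPolynomial (fromNat n)        ∎)
    where
    open ℚ.≤-Reasoning
    -- A walk of length at most `n` cannot leave the box, so the filter misses no vertex of the
    -- ball.
    ball = filter (ball? n u) (box n u)
    ∈-ball : ∀ w → _
    ∈-ball w = mk⇔
      (Equivalence.from (ball⇔walk _≟ᵥ_) ∘ proj₂ ∘ ∈-filter⁻ (ball? n u) {xs = box n u})
      (λ b → let walk = Equivalence.to (ball⇔walk _≟ᵥ_) b in ∈-filter⁺ (ball? n u) (ball⊆box walk) walk)

  -- The ball of radius `stretch * n` contains the box of radius `n`, which has more than
  -- `n ^ (k + 1)` elements. A polynomial of degree at most `k` bounds the ball by a constant times
  -- `n ^ k`, which fails for large `n`.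
  degree-minimal : ∀ u p e → HasDegree p e → GrowthBoundedBy Γ u p → suc k ≤ e
  degree-minimal u p e (_ , high) growth = ≮⇒≥ λ { (s≤s e≤k) → impossible e≤k }
    where
    impossible : ¬ e ≤ k
    impossible e≤k with eval-bounded k p (λ i k<i → high i (≤-<-trans e≤k k<i))
    -- The radius is `stretch * n`, where `n` is one more than the constant `c * stretch ^ k` in
    -- front of `n ^ k`.
    ... | c , p≤ with growth (stretch * suc (c * stretch ^ k))
    ...   | m , (ball , _ , ∈-ball , refl) , m≤p = <-irrefl refl (begin-strict
        c * stretch ^ k * n ^ k                <⟨ m<n+m _ (m^n>0 n k) ⟩
        n * n ^ k                              ≤⟨ ^-monoˡ-≤ (suc k) (m≤n⇒m≤1+n (m≤m+n n n)) ⟩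
        suc (n + n) ^ suc k                    ≡⟨ length-box n u ⟨
        length (box n u)                       ≤⟨ unique-⊆⇒length≤ (box-! n u) box⊆ball ⟩
        length ball                            ≤⟨ fromNat-cancel-≤ (ℚ.≤-trans m≤p (p≤ (stretch * n) (s≤s z≤n))) ⟩
        c * (stretch * n) ^ k                  ≡⟨ cong (c *_) (^-distribʳ-* stretch n k) ⟩
        c * (stretch ^ k * n ^ k)              ≡⟨ *-assoc c (stretch ^ k) (n ^ k) ⟨
        c * stretch ^ k * n ^ k                ∎)
      where
      open ≤-Reasoning
      n = suc (c * stretch ^ k)
      box⊆ball : ∀ {w} → w ∈ box n u → w ∈ ball
      box⊆ball {w} w∈ = Equivalence.from (∈-ball w)
        (Equivalence.from (ball⇔walk _≟ᵥ_) (dist≤⇒walk u w (∈-box⁻ {u = u} {w} w∈)))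

  polynomialGrowth : PolynomialGrowthOfDegree Γ (suc k)
  polynomialGrowth = record
    { connected = connected
    ; bounded   = λ u → boundingPolynomial , boundingPolynomial-degree , growthBounded u
    ; minimal   = degree-minimal
    }

-- Equivalence of rays through bridges far out.

module _ {Γ : Digraph} where

  record Bridge (P : Pred (Vertex Γ) 0ℓ) (R S : Ray Γ) : Set where
    field
      {size}   : ℕ
      path     : Path Γ size
      initial  : _LiesOn_ Γ (Path.initial path) R
      terminal : _LiesOn_ Γ (Path.terminal path) S
      within   : Within P path

  -- All vertices of the n-th bridge have size greater than radius n, and size at most radius (n + 1).
  bridges⇒equivalent : (size : Vertex Γ → ℕ) {R S : Ray Γ} →
    (∀ m → Bridge (λ u → m < size u) R S) → EquivalentRays Γ R S
  bridges⇒equivalent size bridge = record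
    { size     = λ n → Bridge.size (stage n)
    ; path     = λ n → Bridge.path (stage n)
    ; disjoint = disjoint
    ; initial  = λ n → Bridge.initial (stage n)
    ; terminal = λ n → Bridge.terminal (stage n)
    }
    where
    radius : ℕ → ℕ
    radius zero    = 0
    radius (suc n) = radius n ⊔ supremum (size ∘ Path.vertex (Bridge.path (bridge (radius n))))

    stage : ∀ n → Bridge _ _ _
    stage n = bridge (radius n)

    radius-mono : ∀ {m n} → m ≤ n → radius m ≤ radius n
    radius-mono {m} {zero}  z≤n = ≤-refl
    radius-mono {m} {suc n} m≤1+n with m≤n⇒m<n∨m≡n m≤1+n
    ... | inj₁ (s≤s m≤n) = ≤-trans (radius-mono m≤n) (m≤m⊔n _ _)
    ... | inj₂ refl      = ≤-refl

    below : ∀ {m n} → m < n → Disjoint Γ (Bridge.path (stage m)) (Bridge.path (stage n))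
    below {m} {n} m<n i j eq = <-irrefl (cong size eq) (begin-strict
      size (Path.vertex (Bridge.path (stage m)) i)  ≤⟨ ≤-supremum (size ∘ Path.vertex (Bridge.path (stage m))) i ⟩
      supremum (size ∘ Path.vertex (Bridge.path (stage m)))  ≤⟨ m≤n⊔m (radius m) _ ⟩
      radius (suc m)                                ≤⟨ radius-mono m<n ⟩
      radius n                                      <⟨ Bridge.within (stage n) j ⟩
      size (Path.vertex (Bridge.path (stage n)) j)  ∎)
      where open ≤-Reasoning

    disjoint : ∀ m n → m ≢ n → Disjoint Γ (Bridge.path (stage m)) (Bridge.path (stage n))
    disjoint m n m≢n i j with <-cmp m n
    ... | tri< m<n _ _ = below m<n i j
    ... | tri≈ _ m≡n _ = contradiction m≡n m≢n
    ... | tri> _ _ n<m = below n<m j i ∘ sym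

-- The digraph has one end.

module Ends (k : ℕ) .{{_ : NonZero k}} where
  open Residues k
  open Graph k

  origin : Vertex Γ
  origin = 0ℤ , Vec.replicate k 0ℤ

  Far : ℕ → Pred (Vertex Γ) 0ℓ
  Far m u = m < dist origin u

  farLine : ∀ {m v} c → m < ∣ lookup v c ℤ.- lookup (proj₂ origin) c ∣ → ∀ l → Far m (l , v)
  farLine {v = v} c m< l = <-≤-trans m< (dist-coord origin (l , v) c)

  -- Climbing `l` levels brings the level at most `l` closer to 0. The margin `k` covers the range
  -- of levels that `vertical` uses.
  farLevels : ∀ {m i} → m + k < ∣ i ℤ.- proj₁ origin ∣ → ∀ l → l ≤ k → ∀ v → Far m (i ℤ.+ + l , v)
  farLevels {m} {i} m+k< l l≤k v = <-≤-trans (+-cancelʳ-< k m _ (begin-strict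
    m + k                       <⟨ m+k< ⟩
    ∣ i ℤ.- 0ℤ ∣                 ≡⟨ cong ∣_∣ (split i (+ l)) ⟩
    ∣ (i ℤ.+ + l ℤ.- 0ℤ) ℤ.- + l ∣  ≤⟨ ℤ.∣i-j∣≤∣i∣+∣j∣ (i ℤ.+ + l ℤ.- 0ℤ) (+ l) ⟩
    ∣ i ℤ.+ + l ℤ.- 0ℤ ∣ + l       ≤⟨ +-monoʳ-≤ ∣ i ℤ.+ + l ℤ.- 0ℤ ∣ l≤k ⟩
    ∣ i ℤ.+ + l ℤ.- 0ℤ ∣ + k       ∎)) (dist-level origin (i ℤ.+ + l , v))
    where
    open ≤-Reasoning
    split : ∀ i l → i ℤ.- 0ℤ ≡ (i ℤ.+ l ℤ.- 0ℤ) ℤ.- l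
    split = solve-∀

  -- A meeting point for the far vertices. Its coordinates keep every vertex on its horizontal line
  -- at distance more than `m` from the origin, so the line can be followed through level 0.
  hub : ℕ → Vertex Γ
  hub m = 0ℤ , Vec.replicate k (+ suc m)

  farHubLine : ∀ m l → Far m (l , proj₂ (hub m))
  farHubLine m = farLine {v = proj₂ (hub m)} c (≤-reflexive (sym (trans
    (cong₂ (λ x y → ∣ x ℤ.- y ∣) (Vec.lookup-replicate c (+ suc m)) (Vec.lookup-replicate c 0ℤ))
    (cong suc (+-identityʳ m)))))
    -- Any coordinate serves; one exists because `k` is nonzero.
    where c = residue 0ℤ

  -- First give the coordinates the values of the hub while the level is far out, then travel along
  -- the line of the hub, where the coordinates are far out.
  level⇒hub : ∀ {m i} v → m + k < ∣ i ℤ.- 0ℤ ∣ → ∃[ n ] Walk Γ (Far m) n (i , v) (hub m)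
  level⇒hub {m} {i} v m+k< = _ , append
    (vertical {P = Far m} (farLevels {m} {i} m+k<) v (proj₂ (hub m)) (dist-coord (i , v) (i , proj₂ (hub m))))
    (horizontal (farHubLine m) i 0ℤ)

  far⇒hub : ∀ {m} u → Far (m + k) u → ∃[ n ] Walk Γ (Far m) n u (hub m)
  far⇒hub {m} (i , v) far with <-⊔⁻ ∣ i ℤ.- 0ℤ ∣ _ far
  ... | inj₁ m+k< = level⇒hub v m+k<
  ... | inj₂ m+k< with <-supremum⁻ _ m+k<
  -- The large coordinate `c` protects the whole horizontal line, so the level can be moved to
  -- `m + k + 1`, which is far enough for `level⇒hub`.
  ...   | c , m+k<c = _ , append
          (horizontal (farLine {v = v} c (≤-<-trans (m≤m+n m k) m+k<c)) i (+ suc (m + k)))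
          (proj₂ (level⇒hub {i = + suc (m + k)} v (≤-reflexive (cong suc (sym (+-identityʳ (m + k)))))))

  -- Pigeonhole: the vertices of a ray are distinct, so an initial segment with one vertex more than
  -- the box has elements cannot lie inside the box.
  escape : (R : Ray Γ) → ∀ m → ∃[ i ] Far m (Ray.vertex R i)
  escape R m with All.all? (λ i → dist origin (Ray.vertex R i) ≤? m) (upTo (suc (length (box m origin))))
  ... | no ¬all = let i , _ , i≰ = find (¬All⇒Any¬ (λ i → dist origin (Ray.vertex R i) ≤? m) _ ¬all) in i , ≰⇒> i≰
  ... | yes all = contradiction (begin-strict
      length (box m origin)                                        <⟨ ≤-refl ⟩
      suc (length (box m origin))                                  ≡⟨ length-upTo _ ⟨
      length (upTo (suc (length (box m origin))))                  ≡⟨ length-map (Ray.vertex R) (upTo (suc (length (box m origin)))) ⟨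
      length (map (Ray.vertex R) (upTo (suc (length (box m origin)))))
        ≤⟨ unique-⊆⇒length≤ (Unique.map⁺ (Ray.distinct R) (Unique.upTo⁺ _)) segment⊆box ⟩
      length (box m origin)                                        ∎) (<-irrefl refl)
    where
    open ≤-Reasoning
    segment⊆box : ∀ {u} → u ∈ map (Ray.vertex R) (upTo (suc (length (box m origin)))) → u ∈ box m origin
    segment⊆box u∈ with ∈-map⁻ (Ray.vertex R) u∈
    ... | i , i∈ , refl = ∈-box⁺ {u = origin} {Ray.vertex R i} (All.lookup all i∈)

  farBridge : ∀ R S m → Bridge (Far m) R S
  farBridge R S m with escape R (m + k) | escape S (m + k)
  ... | i , farᵢ | j , farⱼ with walk⇒path _≟ᵥ_ (append (proj₂ (far⇒hub (Ray.vertex R i) farᵢ))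
                                                       (reverse (proj₂ (far⇒hub (Ray.vertex S j) farⱼ))))
  ...   | n , _ , p , (initial≡ , terminal≡) , within = record
          { path = p ; initial = i , sym initial≡ ; terminal = j , sym terminal≡ ; within = within }

  -- Shows that there is at least one end.
  levelRay : Ray Γ
  levelRay = record
    { vertex   = λ n → + n , proj₂ origin
    ; distinct = ℤ.+-injective ∘ cong proj₁
    ; step     = λ n → inj₁ (idle-arc {+ n} (proj₂ origin) (cong +_ (+-comm 1 n)))
    }

  oneEnd : OneEnd Γ
  oneEnd = levelRay , λ R S → bridges⇒equivalent (dist origin) (farBridge R S)

-- Automorphisms and `k`-arc-transitivity.

module Transitivity (k : ℕ) .{{_ : NonZero k}} where
  open Residues k
  open Graph k
  open Digraph Γ using (Arc)

  -- Up to an additive constant, the number of levels below i at which coordinate c is active.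
  activations : Fin k → ℤ → ℤ
  activations c i = ℤ.- ((+ toℕ c ℤ.- i) /ℕ k)

  -- Raising `i` by one lowers `c - i` by one. The quotient by `k` drops in this only if `c - i` was
  -- a multiple of `k`, that is, if `c` is active at level `i`.
  activations-idle : ∀ {c i} → ¬ + toℕ c ≋ i → activations c (i ℤ.+ 1ℤ) ≡ activations c i
  activations-idle {c} {i} c≢i = cong ℤ.-_ (trans (cong (_/ℕ k) (regroup (+ toℕ c) i)) (proj₂ (/ℕ-pred (+ toℕ c ℤ.- i)) c-i≢0))
    where
    regroup : ∀ c i → c ℤ.- (i ℤ.+ 1ℤ) ≡ c ℤ.- i ℤ.- 1ℤ
    regroup = solve-∀
    recover : ∀ c i → c ℤ.- i ℤ.+ i ≡ c
    recover = solve-∀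
    c-i≢0 : ¬ + toℕ c ℤ.- i ≋ 0ℤ
    c-i≢0 eq = c≢i (subst₂ _≋_ (recover (+ toℕ c) i) (ℤ.+-identityˡ i) (≋-+ʳ i eq))

  activations-active : ∀ {c i} → + toℕ c ≋ i → activations c (i ℤ.+ 1ℤ) ≡ activations c i ℤ.+ 1ℤ
  activations-active {c} {i} c≋i = trans
    (cong ℤ.-_ (trans (cong (_/ℕ k) (regroup (+ toℕ c) i))
                      (proj₁ (/ℕ-pred (+ toℕ c ℤ.- i)) (subst (+ toℕ c ℤ.- i ≋_) (ℤ.+-inverseʳ i) (≋-+ʳ (ℤ.- i) c≋i)))))
    (negate ((+ toℕ c ℤ.- i) /ℕ k))
    where
    regroup : ∀ c i → c ℤ.- (i ℤ.+ 1ℤ) ≡ c ℤ.- i ℤ.- 1ℤ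
    regroup = solve-∀
    negate : ∀ q → ℤ.- (q ℤ.- 1ℤ) ≡ ℤ.- q ℤ.+ 1ℤ
    negate = solve-∀

  data Twist : Set where
    shift flip : ℤ → Twist

  apply : Twist → Fin k → ℤ → ℤ → ℤ
  apply (shift t) c i x = x ℤ.+ t
  apply (flip t)  c i x = t ℤ.+ activations c i ℤ.- x

  untwist : Twist → Twist
  untwist (shift t) = shift (ℤ.- t)
  untwist (flip t)  = flip t

  apply-untwist : ∀ τ c i x → apply τ c i (apply (untwist τ) c i x) ≡ x
  apply-untwist (shift t) c i x = cancel x t
    where cancel : ∀ x t → x ℤ.- t ℤ.+ t ≡ x
          cancel = solve-∀
  apply-untwist (flip t)  c i x = cancel (t ℤ.+ activations c i) x
    where cancel : ∀ s x → s ℤ.- (s ℤ.- x) ≡ x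
          cancel = solve-∀

  untwist-apply : ∀ τ c i x → apply (untwist τ) c i (apply τ c i x) ≡ x
  untwist-apply (shift t) c i x = cancel x t
    where cancel : ∀ x t → x ℤ.+ t ℤ.- t ≡ x
          cancel = solve-∀
  untwist-apply (flip t)  c i x = apply-untwist (flip t) c i x

  apply-idle : ∀ τ {c i} x → ¬ + toℕ c ≋ i → apply τ c (i ℤ.+ 1ℤ) x ≡ apply τ c i x
  apply-idle (shift t)         x c≢i = refl
  apply-idle (flip t)  {c} {i} x c≢i = cong (λ n → t ℤ.+ n ℤ.- x) (activations-idle c≢i)

  shift-step : ∀ x t → x ℤ.+ 1ℤ ℤ.+ t ≡ x ℤ.+ t ℤ.+ 1ℤ
  shift-step = solve-∀

  flip-still : ∀ t {c i} x → + toℕ c ≋ i → apply (flip t) c (i ℤ.+ 1ℤ) x ≡ apply (flip t) c i x ℤ.+ 1ℤ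
  flip-still t {c} {i} x c≋i =
    trans (cong (λ n → t ℤ.+ n ℤ.- x) (activations-active c≋i)) (regroup t (activations c i) x)
    where
    regroup : ∀ t n x → t ℤ.+ (n ℤ.+ 1ℤ) ℤ.- x ≡ t ℤ.+ n ℤ.- x ℤ.+ 1ℤ
    regroup = solve-∀

  flip-step : ∀ t {c i} x → + toℕ c ≋ i → apply (flip t) c (i ℤ.+ 1ℤ) (x ℤ.+ 1ℤ) ≡ apply (flip t) c i x
  flip-step t {c} {i} x c≋i =
    trans (cong (λ n → t ℤ.+ n ℤ.- (x ℤ.+ 1ℤ)) (activations-active c≋i)) (regroup t (activations c i) x)
    where
    regroup : ∀ t n x → t ℤ.+ (n ℤ.+ 1ℤ) ℤ.- (x ℤ.+ 1ℤ) ≡ t ℤ.+ n ℤ.- x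
    regroup = solve-∀

  apply-active : ∀ τ {c i x y} → + toℕ c ≋ i → Digraph.Arc Θ∞ x y →
    Digraph.Arc Θ∞ (apply τ c i x) (apply τ c (i ℤ.+ 1ℤ) y)
  apply-active (shift t)          c≋i (inj₁ refl) = inj₁ refl
  apply-active (shift t) {x = x} c≋i (inj₂ refl) = inj₂ (shift-step x t)
  apply-active (flip t)  {x = x} c≋i (inj₁ refl) = inj₂ (flip-still t x c≋i)
  apply-active (flip t)  {x = x} c≋i (inj₂ refl) = inj₁ (flip-step t x c≋i)

  twist : (Fin k → Twist) → Vertex Γ → Vertex Γ
  twist τ (i , v) = i , tabulate λ c → apply (τ c) c i (lookup v c)

  lookup-twist : ∀ τ u c → lookup (proj₂ (twist τ u)) c ≡ apply (τ c) c (proj₁ u) (lookup (proj₂ u) c)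
  lookup-twist τ u c = Vec.lookup∘tabulate (λ c → apply (τ c) c (proj₁ u) (lookup (proj₂ u) c)) c

  twist-inverse : ∀ τ σ → (∀ c i x → apply (τ c) c i (apply (σ c) c i x) ≡ x) → ∀ u → twist τ (twist σ u) ≡ u
  twist-inverse τ σ inv u = cong (proj₁ u ,_) (lookup-ext λ c → trans (lookup-twist τ (twist σ u) c)
    (trans (cong (apply (τ c) c (proj₁ u)) (lookup-twist σ u c)) (inv c (proj₁ u) (lookup (proj₂ u) c))))

  twist-arc : ∀ τ u w → Arc u w → Arc (twist τ u) (twist τ w)
  twist-arc τ u@(i , v) w@(j , v′) a with arc-level u w a
  ... | refl = mkArc (twist τ u) (twist τ w) refl
    (λ c c≢i → trans (lookup-twist τ w c) (trans (apply-idle (τ c) {c} {i} (lookup v′ c) c≢i)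
      (trans (cong (apply (τ c) c i) (arc-idle u w a c c≢i)) (sym (lookup-twist τ u c)))))
    (λ c c≋i → subst₂ (Digraph.Arc Θ∞) (sym (lookup-twist τ u c)) (sym (lookup-twist τ w c))
      (apply-active (τ c) {c} {i} c≋i (arc-active u w a c c≋i)))

  twisting : (Fin k → Twist) → Automorphism Γ
  twisting τ = automorphism (twist τ) (twist (untwist ∘ τ))
    (twist-inverse τ (untwist ∘ τ) λ c → apply-untwist (τ c) c)
    (twist-inverse (untwist ∘ τ) τ λ c → untwist-apply (τ c) c)
    (twist-arc τ) (twist-arc (untwist ∘ τ))

  -- When the levels move up by `s`, the coordinate `c` becomes active where `c - s` was active
  -- before, so it has to take over the value found there.
  rotate : ℤ → Vertex Γ → Vertex Γ
  rotate s (i , v) = i ℤ.+ s , tabulate λ c → lookup v (residue (+ toℕ c ℤ.- s))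

  lookup-rotate : ∀ s u c → lookup (proj₂ (rotate s u)) c ≡ lookup (proj₂ u) (residue (+ toℕ c ℤ.- s))
  lookup-rotate s u c = Vec.lookup∘tabulate (λ c → lookup (proj₂ u) (residue (+ toℕ c ℤ.- s))) c

  rotate-inverse : ∀ s t → s ℤ.+ t ≡ 0ℤ → ∀ u → rotate t (rotate s u) ≡ u
  rotate-inverse s t s+t≡0 u@(i , v) = cong₂ _,_
    (trans (ℤ.+-assoc i s t) (trans (cong (ℤ._+_ i) s+t≡0) (ℤ.+-identityʳ i)))
    (lookup-ext λ c → trans (lookup-rotate t (rotate s u) c) (trans (lookup-rotate s u (residue (+ toℕ c ℤ.- t)))
      (cong (lookup v) (sym (≋⇒≡residue (c≋ c))))))
    where
    regroup : ∀ c s t → c ℤ.- t ℤ.- s ≡ c ℤ.- (s ℤ.+ t)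
    regroup = solve-∀
    c≋ : ∀ c → + toℕ c ≋ + toℕ (residue (+ toℕ c ℤ.- t)) ℤ.- s
    c≋ c = ≋-sym (subst (+ toℕ (residue (+ toℕ c ℤ.- t)) ℤ.- s ≋_)
      (trans (regroup (+ toℕ c) s t) (trans (cong (ℤ._-_ (+ toℕ c)) s+t≡0) (ℤ.+-identityʳ (+ toℕ c))))
      (≋-+ʳ (ℤ.- s) (residue-≋ (+ toℕ c ℤ.- t))))

  rotate-arc : ∀ s u w → Arc u w → Arc (rotate s u) (rotate s w)
  rotate-arc s u@(i , v) w@(j , v′) a = mkArc (rotate s u) (rotate s w)
    (trans (cong (ℤ._+ s) (arc-level u w a)) (shift-step i s))
    (λ c c≢ → trans (lookup-rotate s w c) (trans (arc-idle u w a (source c) (c≢ ∘ forth c)) (sym (lookup-rotate s u c))))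
    (λ c c≋ → subst₂ (Digraph.Arc Θ∞) (sym (lookup-rotate s u c)) (sym (lookup-rotate s w c))
      (arc-active u w a (source c) (back c c≋)))
    where
    source : Fin k → Fin k
    source c = residue (+ toℕ c ℤ.- s)
    cancel : ∀ i s → i ℤ.+ s ℤ.- s ≡ i
    cancel = solve-∀
    cancel′ : ∀ i s → i ℤ.- s ℤ.+ s ≡ i
    cancel′ = solve-∀
    forth : ∀ c → + toℕ (source c) ≋ i → + toℕ c ≋ i ℤ.+ s
    forth c eq = subst (_≋ i ℤ.+ s) (cancel′ (+ toℕ c) s) (≋-+ʳ s (≋-trans (≋-sym (residue-≋ (+ toℕ c ℤ.- s))) eq))
    back : ∀ c → + toℕ c ≋ i ℤ.+ s → + toℕ (source c) ≋ i
    back c eq = ≋-trans (residue-≋ (+ toℕ c ℤ.- s)) (subst (+ toℕ c ℤ.- s ≋_) (cancel i s) (≋-+ʳ (ℤ.- s) eq))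

  rotation : ℤ → Automorphism Γ
  rotation s = automorphism (rotate s) (rotate (ℤ.- s))
    (rotate-inverse (ℤ.- s) s (ℤ.+-inverseˡ s)) (rotate-inverse s (ℤ.- s) (ℤ.+-inverseʳ s))
    (rotate-arc s) (rotate-arc (ℤ.- s))

  axis : ℤ → Vertex Γ
  axis i = i , Vec.replicate k 0ℤ

  rotate-axis : ∀ s i → rotate s (axis i) ≡ axis (i ℤ.+ s)
  rotate-axis s i = cong (i ℤ.+ s ,_) (lookup-ext λ c → trans (lookup-rotate s (axis i) c)
    (trans (Vec.lookup-replicate (residue (+ toℕ c ℤ.- s)) 0ℤ) (sym (Vec.lookup-replicate c 0ℤ))))

  module _ {n : ℕ} (a : _-arc Γ n) where
    open _-arc a

    level : Fin (suc n) → ℤ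
    level l = proj₁ (vertex l)

    coord : Fin k → Fin (suc n) → ℤ
    coord c l = lookup (proj₂ (vertex l)) c

    level-suc : ∀ l → level (suc l) ≡ level (inject₁ l) ℤ.+ 1ℤ
    level-suc l = arc-level (vertex (inject₁ l)) (vertex (suc l)) (arc l)

    level≡ : ∀ l → level l ≡ level zero ℤ.+ + toℕ l
    level≡ = <-weakInduction (λ l → level l ≡ level zero ℤ.+ + toℕ l) (sym (ℤ.+-identityʳ (level zero))) λ l eq → begin
      level (suc l)                                  ≡⟨ level-suc l ⟩
      level (inject₁ l) ℤ.+ 1ℤ                       ≡⟨ cong (ℤ._+ 1ℤ) eq ⟩
      level zero ℤ.+ + toℕ (inject₁ l) ℤ.+ 1ℤ        ≡⟨ cong (λ m → level zero ℤ.+ + m ℤ.+ 1ℤ) (Fin.toℕ-inject₁ l) ⟩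
      level zero ℤ.+ + toℕ l ℤ.+ 1ℤ                  ≡⟨ regroup (level zero) (+ toℕ l) ⟩
      level zero ℤ.+ (1ℤ ℤ.+ + toℕ l)                ∎
      where
      open ≡-Reasoning
      regroup : ∀ i l → i ℤ.+ l ℤ.+ 1ℤ ≡ i ℤ.+ (1ℤ ℤ.+ l)
      regroup = solve-∀

    coord-mono : ∀ c l → coord c (inject₁ l) ℤ.≤ coord c (suc l)
    coord-mono c l with arc-coord (vertex (inject₁ l)) (vertex (suc l)) (arc l) c
    ... | inj₁ eq = ℤ.≤-reflexive (sym eq)
    ... | inj₂ eq = subst (coord c (inject₁ l) ℤ.≤_) (sym eq) (ℤ.i≤i+j (coord c (inject₁ l)) 1ℤ)

    -- Coordinates never decrease along arcs. This later forces the coordinates to be constant along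
    -- an arc sequence whose ends have the same coordinates.
    coord≤last : ∀ c l → coord c l ℤ.≤ coord c (fromℕ n)
    coord≤last c = >-weakInduction (λ l → coord c l ℤ.≤ coord c (fromℕ n)) ℤ.≤-refl λ l le → ℤ.≤-trans (coord-mono c l) le

  module _ (a : _-arc Γ k) where
    open _-arc a

    -- A k-arc crosses k consecutive levels, so each coordinate is active at exactly one of its steps.
    activeStep : Fin k → Fin k
    activeStep c = residue (+ toℕ c ℤ.- level a zero)

    -- Step `l` starts at the initial level plus `l`, so the congruence fixes `l` modulo `k`, and
    -- `l` is below `k`.
    active⇒activeStep : ∀ c l → + toℕ c ≋ level a (inject₁ l) → l ≡ activeStep c
    active⇒activeStep c l c≋ = ≋⇒≡residue (≋-sym (subst (+ toℕ c ℤ.- level a zero ≋_) cancel (≋-+ʳ (ℤ.- level a zero) c≋)))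
      where
      lemma : ∀ i l → i ℤ.+ l ℤ.- i ≡ l
      lemma = solve-∀
      cancel : level a (inject₁ l) ℤ.- level a zero ≡ + toℕ l
      cancel = trans (cong (ℤ._- level a zero) (level≡ a (inject₁ l)))
               (trans (lemma (level a zero) (+ toℕ (inject₁ l))) (cong +_ (Fin.toℕ-inject₁ l)))

    Straightens : Fin k → Twist → Set
    Straightens c τ = ∀ l → apply τ c (level a l) (coord a c l) ≡ 0ℤ

    -- At an idle step neither the coordinate nor the twist changes, so the twisted value 0 can be
    -- lost only at the active step.
    straightens : ∀ c τ → apply τ c (level a zero) (coord a c zero) ≡ 0ℤ →
      (∀ l → l ≡ activeStep c → + toℕ c ≋ level a (inject₁ l) →
        apply τ c (level a (inject₁ l) ℤ.+ 1ℤ) (coord a c (suc l)) ≡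
        apply τ c (level a (inject₁ l)) (coord a c (inject₁ l))) →
      Straightens c τ
    straightens c τ base active =
      <-weakInduction (λ l → apply τ c (level a l) (coord a c l) ≡ 0ℤ) base λ l eq →
        trans (cong (λ i → apply τ c i (coord a c (suc l))) (level-suc a l))
              (trans (step l (+ toℕ c ≋? level a (inject₁ l))) eq)
      where
      step : ∀ l → Dec (+ toℕ c ≋ level a (inject₁ l)) →
        apply τ c (level a (inject₁ l) ℤ.+ 1ℤ) (coord a c (suc l)) ≡
        apply τ c (level a (inject₁ l)) (coord a c (inject₁ l))
      step l (yes c≋) = active l (active⇒activeStep c l c≋) c≋
      step l (no c≢)  = trans (apply-idle τ {c} {level a (inject₁ l)} (coord a c (suc l)) c≢)
        (cong (apply τ c (level a (inject₁ l))) (arc-idle (vertex (inject₁ l)) (vertex (suc l)) (arc l) c c≢))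

    -- If the coordinate stays at its active step, it is constant and a translation sends it to 0.
    -- If it climbs there, a flip turns the climb into a stay.
    straighteningTwist : ∀ c → Σ[ τ ∈ Twist ] Straightens c τ
    straighteningTwist c = choose (activeStep c) refl
      where
      x₀ = coord a c zero
      -- Chosen so that the flip sends the initial value `x₀` to 0.
      t  = x₀ ℤ.- activations c (level a zero)
      cancel : ∀ x n → x ℤ.- n ℤ.+ n ℤ.- x ≡ 0ℤ
      cancel = solve-∀
      choose : ∀ s → s ≡ activeStep c → Σ[ τ ∈ Twist ] Straightens c τ
      choose s s≡ with arc-coord (vertex (inject₁ s)) (vertex (suc s)) (arc s) c
      ... | inj₁ eq = shift (ℤ.- x₀) , straightens c (shift (ℤ.- x₀)) (ℤ.+-inverseʳ x₀)
                        λ l l≡ _ → cong (ℤ._+ (ℤ.- x₀)) (still l (trans l≡ (sym s≡)))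
        where
        still : ∀ l → l ≡ s → coord a c (suc l) ≡ coord a c (inject₁ l)
        still _ refl = eq
      ... | inj₂ eq = flip t , straightens c (flip t) (cancel x₀ (activations c (level a zero)))
                        λ l l≡ c≋ → trans (cong (apply (flip t) c (level a (inject₁ l) ℤ.+ 1ℤ)) (moved l (trans l≡ (sym s≡))))
                                          (flip-step t {c} {level a (inject₁ l)} (coord a c (inject₁ l)) c≋)
        where
        moved : ∀ l → l ≡ s → coord a c (suc l) ≡ coord a c (inject₁ l) ℤ.+ 1ℤ
        moved _ refl = eq

    straightening : Σ[ φ ∈ Automorphism Γ ] (∀ l → Automorphism.to φ (vertex l) ≡ axis (level a l))
    straightening = twisting τ , λ l → cong (level a l ,_) (lookup-ext λ c →
      trans (lookup-twist τ (vertex l) c)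
            (trans (proj₂ (straighteningTwist c) l) (sym (Vec.lookup-replicate c 0ℤ))))
      where τ = proj₁ ∘ straighteningTwist

  arcTransitive : ArcTransitive Γ k
  arcTransitive a b with straightening a | straightening b
  ... | φ , φ-axis | ψ , ψ-axis = compose (inverse ψ) (compose (rotation s) φ) , λ l → begin
    ψ.from (rotate s (φ.to (vertex a l)))  ≡⟨ cong (ψ.from ∘ rotate s) (φ-axis l) ⟩
    ψ.from (rotate s (axis (level a l)))   ≡⟨ cong ψ.from (rotate-axis s (level a l)) ⟩
    ψ.from (axis (level a l ℤ.+ s))        ≡⟨ cong (ψ.from ∘ axis) (levels l) ⟩
    ψ.from (axis (level b l))              ≡⟨ cong ψ.from (ψ-axis l) ⟨
    ψ.from (ψ.to (vertex b l))             ≡⟨ from-to ψ (vertex b l) ⟩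
    vertex b l                             ∎
    where
    open ≡-Reasoning
    open _-arc
    module φ = Automorphism φ
    module ψ = Automorphism ψ
    -- Aligns the initial levels; the others follow, since every step raises the level by one.
    s = level b zero ℤ.- level a zero
    regroup : ∀ i j l → i ℤ.+ l ℤ.+ (j ℤ.- i) ≡ j ℤ.+ l
    regroup = solve-∀
    levels : ∀ l → level a l ℤ.+ s ≡ level b l
    levels l = trans (cong (ℤ._+ s) (level≡ a l))
               (trans (regroup (level a zero) (level b zero) (+ toℕ l)) (sym (level≡ b l)))

  -- Failure of `(k + 1)`-arc-transitivity.

  -- The coordinate active at levels 0 and `k`, hence at both the first and the last step of a
  -- `(k + 1)`-arc that starts at level 0.
  c₀ : Fin k
  c₀ = residue 0ℤ

  c₀-active : ∀ {i} → 0ℤ ≋ i → + toℕ c₀ ≋ i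
  c₀-active = ≋-trans (residue-≋ 0ℤ)

  at : ℕ → ℕ → Vertex Γ
  at i h = + i , Vec.replicate k 0ℤ [ c₀ ]≔ + h

  lookup-at : ∀ i h → lookup (proj₂ (at i h)) c₀ ≡ + h
  lookup-at i h = Vec.lookup∘update c₀ (Vec.replicate k 0ℤ) (+ h)

  stay : ∀ i h → Arc (at i h) (at (suc i) h)
  stay i h = idle-arc {+ i} {+ suc i} (Vec.replicate k 0ℤ [ c₀ ]≔ + h) (cong +_ (+-comm 1 i))

  climb : ∀ i h → 0ℤ ≋ + i → Arc (at i h) (at (suc i) (suc h))
  climb i h 0≋i = subst (λ x → Arc (at i h) (+ suc i , Vec.replicate k 0ℤ [ c₀ ]≔ x)) (cong +_ (+-comm h 1))
    (increment-arc {+ i} {+ suc i} (Vec.replicate k 0ℤ) c₀ (+ h) (cong +_ (+-comm 1 i)) (c₀-active 0≋i))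

  -- Only the height of `c₀` varies. The profile `_∸ k` climbs in the last step of a `(k + 1)`-arc,
  -- and `_⊓ 1` climbs in the first.
  profileArc : ∀ n (h : ℕ → ℕ) → (∀ i → i < n → Arc (at i (h i)) (at (suc i) (h (suc i)))) → _-arc Γ n
  profileArc n h arcs = record
    { vertex = λ l → at (toℕ l) (h (toℕ l))
    ; arc    = λ l → subst (λ i → Arc (at i (h i)) (at (suc (toℕ l)) (h (suc (toℕ l)))))
                           (sym (Fin.toℕ-inject₁ l)) (arcs (toℕ l) (Fin.toℕ<n l))
    }

  mapArc : ∀ {n} (f : Vertex Γ → Vertex Γ) → (∀ u w → Arc u w → Arc (f u) (f w)) → _-arc Γ n → _-arc Γ n
  mapArc f f-arc a = record { vertex = f ∘ _-arc.vertex a ; arc = λ l → f-arc _ _ (_-arc.arc a l) }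

  -- There is one (k + 1)-arc from at 0 0 to at (k + 1) 0, but there are two from at 0 0 to at (k + 1) 1.
  flatArc lateArc earlyArc : _-arc Γ (suc k)
  flatArc  = profileArc (suc k) (const 0) λ i _ → stay i 0
  lateArc  = profileArc (suc k) (_∸ k) arcs
    where
    arcs : ∀ i → i < suc k → Arc (at i (i ∸ k)) (at (suc i) (suc i ∸ k))
    arcs i (s≤s i≤k) with m≤n⇒m<n∨m≡n i≤k
    ... | inj₁ i<k  = subst₂ (λ x y → Arc (at i x) (at (suc i) y))
                        (sym (m≤n⇒m∸n≡0 i≤k)) (sym (m≤n⇒m∸n≡0 i<k)) (stay i 0)
    ... | inj₂ refl = subst₂ (λ x y → Arc (at i x) (at (suc i) y))
                        (sym (n∸n≡0 k)) (sym (m+n∸n≡m 1 k)) (climb k 0 (multiple⇒≋ (ℤ.- 1ℤ) (negate (+ k))))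
      where
      negate : ∀ k → 0ℤ ℤ.- k ≡ ℤ.- 1ℤ ℤ.* k
      negate = solve-∀
  earlyArc = profileArc (suc k) (_⊓ 1) λ { zero _ → climb 0 0 ≋-refl ; (suc i) _ → late i }
    where
    late : ∀ i → Arc (at (suc i) (suc i ⊓ 1)) (at (suc (suc i)) (suc (suc i) ⊓ 1))
    late i = subst (λ h → Arc (at (suc i) (suc h)) (at (suc (suc i)) 1)) (sym (⊓-zeroʳ i)) (stay (suc i) 1)

  -- Suppose `φ` carries `flatArc` to `lateArc`. Pulling `earlyArc` back along `φ` gives an arc
  -- sequence with the ends of `flatArc`, which must share its second vertex. Hence `earlyArc` and
  -- `lateArc` agree at level 1, where their heights are 1 and 0.
  ¬arcTransitive : ¬ ArcTransitive Γ (suc k)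
  ¬arcTransitive transitive with transitive flatArc lateArc
  ... | φ , φ-late = contradiction (trans (sym (lookup-at 1 1)) (trans (cong (λ u → lookup (proj₂ u) c₀) early₁≡late₁)
                       (trans (lookup-at 1 (1 ∸ k)) (cong +_ (m≤n⇒m∸n≡0 (>-nonZero⁻¹ k)))))) λ ()
    where
    open ≡-Reasoning
    open _-arc
    module φ = Automorphism φ

    preimage : _-arc Γ (suc k)
    preimage = mapArc φ.from (from-arc φ) earlyArc

    from-late : ∀ l → φ.from (vertex lateArc l) ≡ vertex flatArc l
    from-late l = trans (cong φ.from (sym (φ-late l))) (from-to φ _)

    preimage₀ : vertex preimage zero ≡ vertex flatArc zero
    preimage₀ = trans (cong (λ h → φ.from (at 0 h)) (sym (0∸n≡0 k))) (from-late zero)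

    preimageLast : vertex preimage (fromℕ (suc k)) ≡ vertex flatArc (fromℕ (suc k))
    preimageLast = trans (cong (λ h → φ.from (at (suc (toℕ (fromℕ k))) h)) same) (from-late (fromℕ (suc k)))
      where
      same : suc (toℕ (fromℕ k)) ⊓ 1 ≡ suc (toℕ (fromℕ k)) ∸ k
      same = trans (cong suc (⊓-zeroʳ (toℕ (fromℕ k))))
                   (sym (trans (cong (λ l → suc l ∸ k) (Fin.toℕ-fromℕ k)) (m+n∸n≡m 1 k)))

    preimage₁ : vertex preimage (suc zero) ≡ vertex flatArc (suc zero)
    preimage₁ = cong₂ _,_
      (trans (level-suc preimage zero) (cong (λ u → proj₁ u ℤ.+ 1ℤ) preimage₀))
      -- Each coordinate of the second vertex is squeezed between its values at the two ends, which
      -- coincide because `flatArc` never changes a coordinate.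
      (lookup-ext λ c → ℤ.≤-antisym
        (ℤ.≤-trans (coord≤last preimage c (suc zero)) (ℤ.≤-reflexive (cong (λ u → lookup (proj₂ u) c) preimageLast)))
        (ℤ.≤-trans (ℤ.≤-reflexive (sym (cong (λ u → lookup (proj₂ u) c) preimage₀))) (coord-mono preimage c zero)))

    early₁≡late₁ : vertex earlyArc (suc zero) ≡ vertex lateArc (suc zero)
    early₁≡late₁ = begin
      vertex earlyArc (suc zero)          ≡⟨ to-from φ _ ⟨
      φ.to (vertex preimage (suc zero))   ≡⟨ cong φ.to preimage₁ ⟩
      φ.to (vertex flatArc (suc zero))    ≡⟨ φ-late (suc zero) ⟩
      vertex lateArc (suc zero)           ∎

  sharplyArcTransitive : SharplyArcTransitive Γ k
  sharplyArcTransitive = arcTransitive , ¬arcTransitive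

corollary14 : (k : ℕ) .{{_ : NonZero k}} →
    PolynomialGrowthOfDegree ℤ[ Θ∞ , k ] (suc k) ×
    OneEnd ℤ[ Θ∞ , k ] ×
    SharplyArcTransitive ℤ[ Θ∞ , k ] k
corollary14 k = Growth.polynomialGrowth k , Ends.oneEnd k , Transitivity.sharplyArcTransitive k
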